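{- Let $k\in\mathbb{Z}$, let $n\ge 0$ be an integer, and let $x,y\in\mathbb{C}$. For every nonzero $\lambda\in\mathbb{C}$, $$\beta_{n,\lambda}^{(k)}(x+y)=\sum_{l=0}^{n}\binom{n}{l}\left(\frac{y}{\lambda}\right)_{n-l}\lambda^{n-l}\,\beta_{l,\lambda}^{(k)}(x),$$ and moreover $$\lim_{\lambda\to 0}\beta_{n,\lambda}^{(k)}(x)=B_{n}^{(k)}(x).$$
   Context: For $k\in\mathbb{Z}$, the polylogarithm is the power series $\mathrm{Li}_k(u)=\sum_{n=1}^{\infty}\frac{u^n}{n^k}$. For nonzero $\lambda$, the fully degenerate poly-Bernoulli polynomials $\beta_{n,\lambda}^{(k)}(x)$ are defined by the generating function (identity of formal power series in $t$) $$\frac{\mathrm{Li}_{k}\left(1-(1+\lambda t)^{ -1/\lambda}\right)}{1-(1+\lambda t)^{ -1/\lambda}}(1+\lambda t)^{x/\lambda}=\sum_{n=0}^{\infty}\beta_{n,\lambda}^{(k)}(x)\frac{t^{n}}{n!},$$ where $(1+\lambda t)^{a}=\sum_{j\ge0}(a)_j\lambda^j\frac{t^j}{j!}$ and $\mathrm{Li}_k(u)/u$ denotes the series $\sum_{m\ge 0}u^m/(m+1)^k$. The poly-Bernoulli polynomials $B_n^{(k)}(x)$ are defined by $$\frac{\mathrm{Li}_{k}(1-e^{ -t})}{1-e^{ -t}}e^{xt}=\sum_{n=0}^{\infty}B_{n}^{(k)}(x)\frac{t^{n}}{n!}.$$ Here $(a)_n=a(a-1)\cdots(a-n+1)$ with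 $(a)_0=1$ is the falling factorial. The limit is taken through nonzero $\lambda$. -}

module Defs where

open import Algebra.Bundles.Raw using (RawRing)
import Algebra.Definitions.RawSemiring as RawSemiringDefs
open import Data.Fin.Base using (toℕ)
open import Data.Integer.Base as ℤ using (ℤ; +_; -[1+_])
open import Data.Nat.Base as ℕ using (ℕ; zero; suc; _∸_; _!)
import Data.Nat.Properties as ℕₚ
open import Data.Product.Base using (∃; _×_; _,_)
open import Data.Rational.Base as ℚ using (ℚ; 0ℚ; 1ℚ)
import Data.Rational.Properties as ℚₚ
open import Data.Rational.Solver using (module +-*-Solver)
open import Level using (0ℓ)
open import Relation.Binary.PropositionalEquality
  using (_≡_; refl; sym; trans; cong; cong₂; subst; module ≡-Reasoning)
open import Relation.Nullary.Decidable.Core using (yes; no)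
open import Relation.Nullary.Negation.Core using (¬_; contradiction)

-- The modulus of convergence is part of the data.
Cauchy : (ℕ → ℚ) → Set
Cauchy s = ∀ ε → 0ℚ ℚ.< ε →
  ∃ λ N → ∀ m n → N ℕ.≤ m → N ℕ.≤ n → ℚ.∣ s m ℚ.- s n ∣ ℚ.< ε

record ℝ : Set where
  constructor mkℝ
  field
    seq    : ℕ → ℚ
    cauchy : Cauchy seq

open ℝ public

infix 4 _≃ℝ_ _<ℝ_

_≃ℝ_ : ℝ → ℝ → Set
x ≃ℝ y = ∀ ε → 0ℚ ℚ.< ε →
  ∃ λ N → ∀ n → N ℕ.≤ n → ℚ.∣ seq x n ℚ.- seq y n ∣ ℚ.< ε

-- The rational gap must be uniform: an eventual pointwise inequality would
-- only give x ≤ y in the limit.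
_<ℝ_ : ℝ → ℝ → Set
x <ℝ y = ∃ λ ε → 0ℚ ℚ.< ε ×
  ∃ λ N → ∀ n → N ℕ.≤ n → ε ℚ.< seq y n ℚ.- seq x n

private
  variable
    s t : ℕ → ℚ

addAux : ∀ a b c d →
  (a ℚ.+ b) ℚ.- (c ℚ.+ d) ≡ (a ℚ.- c) ℚ.+ (b ℚ.- d)
addAux = solve 4 (λ a b c d →
  (a :+ b) :- (c :+ d) := (a :- c) :+ (b :- d)) refl
  where open +-*-Solver

mulAux : ∀ a b c d →
  a ℚ.* b ℚ.- c ℚ.* d ≡ a ℚ.* (b ℚ.- d) ℚ.+ d ℚ.* (a ℚ.- c)
mulAux = solve 4 (λ a b c d →
  a :* b :- c :* d := a :* (b :- d) :+ d :* (a :- c)) refl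
  where open +-*-Solver

negAux : ∀ a b → (ℚ.- a) ℚ.- (ℚ.- b) ≡ ℚ.- (a ℚ.- b)
negAux = solve 2 (λ a b → (:- a) :- (:- b) := :- (a :- b)) refl
  where open +-*-Solver

splitAux : ∀ a b → a ≡ (a ℚ.- b) ℚ.+ b
splitAux = solve 2 (λ a b → a := (a :- b) :+ b) refl
  where open +-*-Solver

*-pos : ∀ {p q} → 0ℚ ℚ.< p → 0ℚ ℚ.< q → 0ℚ ℚ.< p ℚ.* q
*-pos {p} {q} 0<p 0<q =
  subst (ℚ._< p ℚ.* q) (ℚₚ.*-zeroʳ p) (ℚₚ.*-monoʳ-<-pos p {{ℚ.positive 0<p}} 0<q)

divide : ∀ S ε → 0ℚ ℚ.< S → 0ℚ ℚ.< ε →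
  ∃ λ δ → 0ℚ ℚ.< δ × S ℚ.* δ ≡ ε
divide S ε 0<S 0<ε = r ℚ.* ε , *-pos {r} {ε} 0<r 0<ε , (begin
  S ℚ.* (r ℚ.* ε)    ≡⟨ ℚₚ.*-assoc S r ε ⟨
  (S ℚ.* r) ℚ.* ε    ≡⟨ cong (λ v → v ℚ.* ε) (ℚₚ.*-inverseʳ S {{S≢0}}) ⟩
  1ℚ ℚ.* ε           ≡⟨ ℚₚ.*-identityˡ ε ⟩
  ε                  ∎)
  where
  open ≡-Reasoning
  S≢0 : ℚ.NonZero S
  S≢0 = ℚ.>-nonZero 0<S
  r : ℚ
  r = ℚ.1/_ S {{S≢0}}
  0<r : 0ℚ ℚ.< r
  0<r = ℚₚ.positive⁻¹ r {{ℚₚ.1/pos⇒pos S {{ℚ.positive 0<S}}}}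

*-mono-<-bounded : ∀ {a b B D} → ℚ.∣ a ∣ ℚ.< B → ℚ.∣ b ∣ ℚ.< D →
  ℚ.∣ a ℚ.* b ∣ ℚ.< B ℚ.* D
*-mono-<-bounded {a} {b} {B} {D} a<B b<D = begin-strict
  ℚ.∣ a ℚ.* b ∣          ≡⟨ ℚₚ.∣p*q∣≡∣p∣*∣q∣ a b ⟩
  ℚ.∣ a ∣ ℚ.* ℚ.∣ b ∣    ≤⟨ ℚₚ.*-monoˡ-≤-nonNeg ℚ.∣ a ∣ {{ℚₚ.∣-∣-nonNeg a}} (ℚₚ.<⇒≤ b<D) ⟩
  ℚ.∣ a ∣ ℚ.* D          <⟨ ℚₚ.*-monoˡ-<-pos D {{ℚ.positive 0<D}} a<B ⟩
  B ℚ.* D                ∎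
  where
  open ℚₚ.≤-Reasoning
  0<D : 0ℚ ℚ.< D
  0<D = ℚₚ.≤-<-trans (ℚₚ.0≤∣p∣ b) b<D

bounded : Cauchy s → ∃ λ B → 0ℚ ℚ.< B ×
  ∃ λ N → ∀ n → N ℕ.≤ n → ℚ.∣ s n ∣ ℚ.< B
bounded {s} cs with cs 1ℚ (ℚₚ.positive⁻¹ 1ℚ)
... | N , close = 1ℚ ℚ.+ ℚ.∣ s N ∣ , 0<B , N , bound
  where
  open ℚₚ.≤-Reasoning
  0<B : 0ℚ ℚ.< 1ℚ ℚ.+ ℚ.∣ s N ∣
  0<B = ℚₚ.+-mono-<-≤ (ℚₚ.positive⁻¹ 1ℚ) (ℚₚ.0≤∣p∣ (s N))
  bound : ∀ n → N ℕ.≤ n → ℚ.∣ s n ∣ ℚ.< 1ℚ ℚ.+ ℚ.∣ s N ∣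
  bound n N≤n = begin-strict
    ℚ.∣ s n ∣                             ≡⟨ cong ℚ.∣_∣ (splitAux (s n) (s N)) ⟩
    ℚ.∣ (s n ℚ.- s N) ℚ.+ s N ∣           ≤⟨ ℚₚ.∣p+q∣≤∣p∣+∣q∣ (s n ℚ.- s N) (s N) ⟩
    ℚ.∣ s n ℚ.- s N ∣ ℚ.+ ℚ.∣ s N ∣       <⟨ ℚₚ.+-monoˡ-< ℚ.∣ s N ∣ (close n N N≤n ℕₚ.≤-refl) ⟩
    1ℚ ℚ.+ ℚ.∣ s N ∣                      ∎

*-diff : ∀ a b c d {B D δ ε} → ℚ.∣ a ∣ ℚ.< B → ℚ.∣ d ∣ ℚ.< D →
    ℚ.∣ a ℚ.- c ∣ ℚ.< δ → ℚ.∣ b ℚ.- d ∣ ℚ.< δ → (B ℚ.+ D) ℚ.* δ ≡ ε →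
    ℚ.∣ a ℚ.* b ℚ.- c ℚ.* d ∣ ℚ.< ε
*-diff a b c d {B} {D} {δ} {ε} a<B d<D ac bd eq = begin-strict
    ℚ.∣ a ℚ.* b ℚ.- c ℚ.* d ∣
      ≡⟨ cong ℚ.∣_∣ (mulAux a b c d) ⟩
    ℚ.∣ a ℚ.* (b ℚ.- d) ℚ.+ d ℚ.* (a ℚ.- c) ∣
      ≤⟨ ℚₚ.∣p+q∣≤∣p∣+∣q∣ (a ℚ.* (b ℚ.- d)) (d ℚ.* (a ℚ.- c)) ⟩
    ℚ.∣ a ℚ.* (b ℚ.- d) ∣ ℚ.+ ℚ.∣ d ℚ.* (a ℚ.- c) ∣
      <⟨ ℚₚ.+-mono-< (*-mono-<-bounded {a} {b ℚ.- d} a<B bd)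
                     (*-mono-<-bounded {d} {a ℚ.- c} d<D ac) ⟩
    B ℚ.* δ ℚ.+ D ℚ.* δ
      ≡⟨ ℚₚ.*-distribʳ-+ δ B D ⟨
    (B ℚ.+ D) ℚ.* δ
      ≡⟨ eq ⟩
    ε ∎
  where open ℚₚ.≤-Reasoning

opaque
  const-cauchy : ∀ q → Cauchy (λ _ → q)
  const-cauchy q ε 0<ε = 0 , λ _ _ _ _ →
    subst (ℚ._< ε) (sym (cong ℚ.∣_∣ (ℚₚ.+-inverseʳ q))) 0<ε

  neg-cauchy : Cauchy s → Cauchy (λ n → ℚ.- s n)
  neg-cauchy {s} cs ε 0<ε with cs ε 0<ε
  ... | N , close = N , λ m n N≤m N≤n →
    subst (ℚ._< ε)
      (sym (trans (cong ℚ.∣_∣ (negAux (s m) (s n))) (ℚₚ.∣-p∣≡∣p∣ (s m ℚ.- s n))))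
      (close m n N≤m N≤n)

  +-cauchy : Cauchy s → Cauchy t → Cauchy (λ n → s n ℚ.+ t n)
  +-cauchy {s} {t} cs ct ε 0<ε = go (cs h 0<h) (ct h 0<h)
    where
    open ℚₚ.≤-Reasoning
    h : ℚ
    h = ℚ.½ ℚ.* ε
    0<h : 0ℚ ℚ.< h
    0<h = *-pos (ℚₚ.positive⁻¹ ℚ.½) 0<ε
    h+h : h ℚ.+ h ≡ ε
    h+h = trans (sym (ℚₚ.*-distribʳ-+ ε ℚ.½ ℚ.½)) (ℚₚ.*-identityˡ ε)
    go : (∃ λ N → ∀ m n → N ℕ.≤ m → N ℕ.≤ n → ℚ.∣ s m ℚ.- s n ∣ ℚ.< h) →
         (∃ λ N → ∀ m n → N ℕ.≤ m → N ℕ.≤ n → ℚ.∣ t m ℚ.- t n ∣ ℚ.< h) →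
         ∃ λ N → ∀ m n → N ℕ.≤ m → N ℕ.≤ n →
           ℚ.∣ (s m ℚ.+ t m) ℚ.- (s n ℚ.+ t n) ∣ ℚ.< ε
    go (M , cM) (N , cN) = M ℕ.⊔ N , λ m n p q → begin-strict
      ℚ.∣ (s m ℚ.+ t m) ℚ.- (s n ℚ.+ t n) ∣       ≡⟨ cong ℚ.∣_∣ (addAux (s m) (t m) (s n) (t n)) ⟩
      ℚ.∣ (s m ℚ.- s n) ℚ.+ (t m ℚ.- t n) ∣       ≤⟨ ℚₚ.∣p+q∣≤∣p∣+∣q∣ (s m ℚ.- s n) (t m ℚ.- t n) ⟩
      ℚ.∣ s m ℚ.- s n ∣ ℚ.+ ℚ.∣ t m ℚ.- t n ∣     <⟨ ℚₚ.+-mono-<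
        (cM m n (ℕₚ.m⊔n≤o⇒m≤o M N p) (ℕₚ.m⊔n≤o⇒m≤o M N q))
        (cN m n (ℕₚ.m⊔n≤o⇒n≤o M N p) (ℕₚ.m⊔n≤o⇒n≤o M N q)) ⟩
      h ℚ.+ h                                     ≡⟨ h+h ⟩
      ε                                           ∎

  *-cauchy : Cauchy s → Cauchy t → Cauchy (λ n → s n ℚ.* t n)
  *-cauchy {s} {t} cs ct ε 0<ε =
    let B , 0<B , M₁ , s<B = bounded {s} cs
        D , 0<D , M₂ , t<D = bounded {t} ct
        δ , 0<δ , eq       = divide (B ℚ.+ D) ε (ℚₚ.+-mono-< 0<B 0<D) 0<ε
        N₁ , c₁            = cs δ 0<δ
        N₂ , c₂            = ct δ 0<δ
    in combine B D δ M₁ M₂ N₁ N₂ eq s<B t<D c₁ c₂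
    where
    combine : ∀ B D δ M₁ M₂ N₁ N₂ → (B ℚ.+ D) ℚ.* δ ≡ ε →
      (∀ n → M₁ ℕ.≤ n → ℚ.∣ s n ∣ ℚ.< B) →
      (∀ n → M₂ ℕ.≤ n → ℚ.∣ t n ∣ ℚ.< D) →
      (∀ m n → N₁ ℕ.≤ m → N₁ ℕ.≤ n → ℚ.∣ s m ℚ.- s n ∣ ℚ.< δ) →
      (∀ m n → N₂ ℕ.≤ m → N₂ ℕ.≤ n → ℚ.∣ t m ℚ.- t n ∣ ℚ.< δ) →
      ∃ λ N → ∀ m n → N ℕ.≤ m → N ℕ.≤ n →
        ℚ.∣ s m ℚ.* t m ℚ.- s n ℚ.* t n ∣ ℚ.< ε
    combine B D δ M₁ M₂ N₁ N₂ eq s<B t<D c₁ c₂ =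
      (M₁ ℕ.⊔ M₂) ℕ.⊔ (N₁ ℕ.⊔ N₂) , λ m n p q →
      let pM = ℕₚ.m⊔n≤o⇒m≤o (M₁ ℕ.⊔ M₂) (N₁ ℕ.⊔ N₂) p
          pN = ℕₚ.m⊔n≤o⇒n≤o (M₁ ℕ.⊔ M₂) (N₁ ℕ.⊔ N₂) p
          qM = ℕₚ.m⊔n≤o⇒m≤o (M₁ ℕ.⊔ M₂) (N₁ ℕ.⊔ N₂) q
          qN = ℕₚ.m⊔n≤o⇒n≤o (M₁ ℕ.⊔ M₂) (N₁ ℕ.⊔ N₂) q
      in *-diff (s m) (t m) (s n) (t n)
           (s<B m (ℕₚ.m⊔n≤o⇒m≤o M₁ M₂ pM))
           (t<D n (ℕₚ.m⊔n≤o⇒n≤o M₁ M₂ qM))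
           (c₁ m n (ℕₚ.m⊔n≤o⇒m≤o N₁ N₂ pN) (ℕₚ.m⊔n≤o⇒m≤o N₁ N₂ qN))
           (c₂ m n (ℕₚ.m⊔n≤o⇒n≤o N₁ N₂ pN) (ℕₚ.m⊔n≤o⇒n≤o N₁ N₂ qN))
           eq

-- Totalised with recip 0ℚ ≡ 0ℚ; for a positive real only finitely many terms
-- can take the junk value.
recip : ℚ → ℚ
recip p with p ℚₚ.≟ 0ℚ
... | yes _   = 0ℚ
... | no  p≢0 = ℚ.1/_ p {{ℚ.≢-nonZero p≢0}}

*-recip : ∀ p → ¬ p ≡ 0ℚ → p ℚ.* recip p ≡ 1ℚ
*-recip p p≢0 with p ℚₚ.≟ 0ℚ
... | yes p≡0 = contradiction p≡0 p≢0
... | no  q   = ℚₚ.*-inverseʳ p {{ℚ.≢-nonZero q}}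

fromℚ : ℚ → ℝ
fromℚ q = mkℝ (λ _ → q) (const-cauchy q)

0ℝ 1ℝ : ℝ
0ℝ = fromℚ 0ℚ
1ℝ = fromℚ 1ℚ

infixl 6 _+ℝ_ _-ℝ_
infixl 7 _*ℝ_
infix  8 -ℝ_

_+ℝ_ _*ℝ_ : ℝ → ℝ → ℝ
x +ℝ y = mkℝ (λ n → seq x n ℚ.+ seq y n) (+-cauchy {seq x} {seq y} (cauchy x) (cauchy y))
x *ℝ y = mkℝ (λ n → seq x n ℚ.* seq y n) (*-cauchy {seq x} {seq y} (cauchy x) (cauchy y))

-ℝ_ : ℝ → ℝ
-ℝ x = mkℝ (λ n → ℚ.- seq x n) (neg-cauchy {seq x} (cauchy x))

_-ℝ_ : ℝ → ℝ → ℝ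
x -ℝ y = x +ℝ (-ℝ y)

opaque
  recip-cauchy : ∀ x → 0ℝ <ℝ x → Cauchy (λ n → recip (seq x n))
  recip-cauchy x (ε , 0<ε , M , ε<x) η 0<η =
    go (cauchy x (η ℚ.* (ε ℚ.* ε)) (*-pos 0<η 0<εε))
    where
    open ℚₚ.≤-Reasoning
    0<εε : 0ℚ ℚ.< ε ℚ.* ε
    0<εε = *-pos 0<ε 0<ε

    ε<xₙ : ∀ n → M ℕ.≤ n → ε ℚ.< seq x n
    ε<xₙ n M≤n = subst (ε ℚ.<_) (ℚₚ.+-identityʳ (seq x n)) (ε<x n M≤n)

    xₙ≢0 : ∀ n → M ℕ.≤ n → ¬ seq x n ≡ 0ℚ
    xₙ≢0 n M≤n eq = ℚₚ.<-irrefl (sym eq) (ℚₚ.<-trans 0<ε (ε<xₙ n M≤n))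

    rearrange : ∀ a b r u → a ℚ.* r ≡ 1ℚ → b ℚ.* u ≡ 1ℚ →
      (r ℚ.- u) ℚ.* (a ℚ.* b) ≡ ℚ.- (a ℚ.- b)
    rearrange a b r u ar bu = trans (expand a b r u)
      (trans (cong₂ (λ v w → v ℚ.* b ℚ.- w ℚ.* a) ar bu) (collect a b))
      where
      open +-*-Solver
      expand : ∀ a b r u → (r ℚ.- u) ℚ.* (a ℚ.* b) ≡
        (a ℚ.* r) ℚ.* b ℚ.- (b ℚ.* u) ℚ.* a
      expand = solve 4 (λ a b r u →
        (r :- u) :* (a :* b) := (a :* r) :* b :- (b :* u) :* a) refl
      collect : ∀ a b → 1ℚ ℚ.* b ℚ.- 1ℚ ℚ.* a ≡ ℚ.- (a ℚ.- b)
      collect = solve 2 (λ a b →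
        con 1ℚ :* b :- con 1ℚ :* a := :- (a :- b)) refl

    εε≤ : ∀ m n → M ℕ.≤ m → M ℕ.≤ n →
      ε ℚ.* ε ℚ.≤ ℚ.∣ seq x m ℚ.* seq x n ∣
    εε≤ m n p q = begin
      ε ℚ.* ε                        ≤⟨ ℚₚ.*-monoʳ-≤-nonNeg ε {{ℚₚ.pos⇒nonNeg ε {{ℚ.positive 0<ε}}}} (ℚₚ.<⇒≤ (ε<xₙ m p)) ⟩
      seq x m ℚ.* ε                  ≤⟨ ℚₚ.*-monoˡ-≤-nonNeg (seq x m) {{ℚₚ.pos⇒nonNeg (seq x m) {{ℚ.positive (ℚₚ.<-trans 0<ε (ε<xₙ m p))}}}} (ℚₚ.<⇒≤ (ε<xₙ n q)) ⟩
      seq x m ℚ.* seq x n            ≡⟨ ℚₚ.0≤p⇒∣p∣≡p (ℚₚ.<⇒≤ (*-pos (ℚₚ.<-trans 0<ε (ε<xₙ m p)) (ℚₚ.<-trans 0<ε (ε<xₙ n q)))) ⟨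
      ℚ.∣ seq x m ℚ.* seq x n ∣      ∎

    go : (∃ λ N → ∀ m n → N ℕ.≤ m → N ℕ.≤ n →
           ℚ.∣ seq x m ℚ.- seq x n ∣ ℚ.< η ℚ.* (ε ℚ.* ε)) →
         ∃ λ N → ∀ m n → N ℕ.≤ m → N ℕ.≤ n →
           ℚ.∣ recip (seq x m) ℚ.- recip (seq x n) ∣ ℚ.< η
    go (N , close) = M ℕ.⊔ N , λ m n p q →
      let a = seq x m; b = seq x n
          r = recip a; u = recip b
          pM = ℕₚ.m⊔n≤o⇒m≤o M N p
          qM = ℕₚ.m⊔n≤o⇒m≤o M N q
      in ℚₚ.*-cancelʳ-<-nonNeg (ε ℚ.* ε) {{ℚₚ.pos⇒nonNeg (ε ℚ.* ε) {{ℚ.positive 0<εε}}}} (begin-strict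
        ℚ.∣ r ℚ.- u ∣ ℚ.* (ε ℚ.* ε)
          ≤⟨ ℚₚ.*-monoˡ-≤-nonNeg ℚ.∣ r ℚ.- u ∣ {{ℚₚ.∣-∣-nonNeg (r ℚ.- u)}} (εε≤ m n pM qM) ⟩
        ℚ.∣ r ℚ.- u ∣ ℚ.* ℚ.∣ a ℚ.* b ∣
          ≡⟨ ℚₚ.∣p*q∣≡∣p∣*∣q∣ (r ℚ.- u) (a ℚ.* b) ⟨
        ℚ.∣ (r ℚ.- u) ℚ.* (a ℚ.* b) ∣
          ≡⟨ cong ℚ.∣_∣ (rearrange a b r u (*-recip a (xₙ≢0 m pM)) (*-recip b (xₙ≢0 n qM))) ⟩
        ℚ.∣ ℚ.- (a ℚ.- b) ∣
          ≡⟨ ℚₚ.∣-p∣≡∣p∣ (a ℚ.- b) ⟩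
        ℚ.∣ a ℚ.- b ∣
          <⟨ close m n (ℕₚ.m⊔n≤o⇒n≤o M N p) (ℕₚ.m⊔n≤o⇒n≤o M N q) ⟩
        η ℚ.* (ε ℚ.* ε) ∎)

inverseℝ : (x : ℝ) → 0ℝ <ℝ x → ℝ
inverseℝ x 0<x = mkℝ (λ n → recip (seq x n)) (recip-cauchy x 0<x)

record ℂ : Set where
  constructor _+i_
  field
    re im : ℝ

open ℂ public

infix 4 _≃_ _#0

_≃_ : ℂ → ℂ → Set
z ≃ w = re z ≃ℝ re w × im z ≃ℝ im w

infixl 6 _+_ _-_
infixl 7 _*_
infix  8 -_

_+_ _*_ : ℂ → ℂ → ℂ
z + w = (re z +ℝ re w) +i (im z +ℝ im w)
z * w = (re z *ℝ re w -ℝ im z *ℝ im w) +i (re z *ℝ im w +ℝ im z *ℝ re w)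

-_ : ℂ → ℂ
- z = (-ℝ re z) +i (-ℝ im z)

_-_ : ℂ → ℂ → ℂ
z - w = z + (- w)

fromℚᶜ : ℚ → ℂ
fromℚᶜ q = fromℚ q +i 0ℝ

fromℕ : ℕ → ℂ
fromℕ n = fromℚᶜ (+ n ℚ./ 1)

0ℂ 1ℂ : ℂ
0ℂ = fromℚᶜ 0ℚ
1ℂ = fromℚᶜ 1ℚ

normSq : ℂ → ℝ
normSq z = re z *ℝ re z +ℝ im z *ℝ im z

-- Nonzero in the constructive sense (apartness from 0): the negation of
-- z ≃ 0ℂ, which is classically equivalent, does not suffice to define 1/z.
_#0 : ℂ → Set
z #0 = 0ℝ <ℝ normSq z

inverse : (z : ℂ) → z #0 → ℂ
inverse z z#0 = (re z *ℝ r) +i ((-ℝ im z) *ℝ r)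
  where
  r : ℝ
  r = inverseℝ (normSq z) z#0

-- |z| < r for r > 0, squared to avoid the square root in |z|.
∣_∣<_ : ℂ → ℝ → Set
∣ z ∣< r = normSq z <ℝ r *ℝ r

-- The limit as z → 0 through nonzero z of a function defined for nonzero z.
Limit₀ : ((z : ℂ) → z #0 → ℂ) → ℂ → Set
Limit₀ f L = ∀ (ε : ℝ) → 0ℝ <ℝ ε →
  ∃ λ (δ : ℝ) → 0ℝ <ℝ δ ×
    (∀ (z : ℂ) (z#0 : z #0) → ∣ z ∣< δ → ∣ f z z#0 - L ∣< ε)

ℂ-rawRing : RawRing 0ℓ 0ℓ
ℂ-rawRing = record
  { Carrier = ℂ
  ; _≈_     = _≃_
  ; _+_     = _+_
  ; _*_     = _*_
  ; -_      = -_
  ; 0#      = 0ℂ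
  ; 1#      = 1ℂ
  }

open RawSemiringDefs (RawRing.rawSemiring ℂ-rawRing) public
  using (_^_; sum)

-- ∑≤ n f = f 0 + f 1 + ⋯ + f n
∑≤ : ℕ → (ℕ → ℂ) → ℂ
∑≤ n f = sum {suc n} (λ i → f (toℕ i))

fallingFactorial : ℂ → ℕ → ℂ
fallingFactorial a zero    = 1ℂ
fallingFactorial a (suc n) = fallingFactorial a n * (a - fromℕ n)

-- f n is the coefficient of tⁿ.
Series : Set
Series = ℕ → ℂ

infixl 6 _-ₛ_
infixl 7 _*ₛ_
infixr 9 _∘ₛ_

1ₛ : Series
1ₛ zero    = 1ℂ
1ₛ (suc _) = 0ℂ

_-ₛ_ _*ₛ_ : Series → Series → Series
(f -ₛ g) n = f n - g n
(f *ₛ g) n = ∑≤ n (λ i → f i * g (n ∸ i))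

powerₛ : Series → ℕ → Series
powerₛ f zero    = 1ₛ
powerₛ f (suc m) = f *ₛ powerₛ f m

-- The substitution ∑ₘ fₘ gᵐ, for g with zero constant term only: then gᵐ
-- starts in degree ≥ m, so the terms with m > n do not contribute to tⁿ.
_∘ₛ_ : Series → Series → Series
(f ∘ₛ g) n = ∑≤ n (λ m → f m * powerₛ g m n)

1/! : ℕ → ℂ
1/! n = fromℚᶜ (ℚ._/_ (+ 1) (n !) {{n ℕₚ.!≢0}})

-- The sequence (aₙ) with f = ∑ₙ aₙ tⁿ/n!.
egfCoefficient : Series → ℕ → ℂ
egfCoefficient f n = fromℕ (n !) * f n

-- exp[ x ] is e^(xt).
exp[_] : ℂ → Series
exp[ x ] n = (x ^ n) * 1/! n

-- binomialSeries c a is (1 + ct)^a.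
binomialSeries : ℂ → ℂ → Series
binomialSeries c a j = fallingFactorial a j * (c ^ j) * 1/! j

-- 1/nᵏ
recipPower : (n : ℕ) .{{_ : ℕ.NonZero n}} → ℤ → ℚ
recipPower n (+ k)    = ℚ._/_ (+ 1) (n ℕ.^ k) {{ℕₚ.m^n≢0 n k}}
recipPower n -[1+ k ] = + (n ℕ.^ suc k) ℚ./ 1

-- Liₖ(u)/u = ∑ₘ uᵐ/(m+1)ᵏ
Li/u : ℤ → Series
Li/u k m = fromℚᶜ (recipPower (suc m) k)

-- In both definitions the substituted series has the form 1 - (1 + O(t)), so
-- its constant term vanishes.

polyBernoulli : ℤ → ℕ → ℂ → ℂ
polyBernoulli k n x = egfCoefficient
  ((Li/u k ∘ₛ (1ₛ -ₛ exp[ - 1ℂ ])) *ₛ exp[ x ]) n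

degeneratePolyBernoulli : ℤ → ℕ → (c : ℂ) → c #0 → ℂ → ℂ
degeneratePolyBernoulli k n c c#0 x = egfCoefficient
  ((Li/u k ∘ₛ (1ₛ -ₛ binomialSeries c (- inverse c c#0)))
    *ₛ binomialSeries c (x * inverse c c#0)) n

{-# OPTIONS --safe #-}
module Submission where

-- The series (1 + ct)^(x/c) is the unique solution of (1 + ct) f′ = x f, f(0) = 1,
-- that is, of (n + 1) fₙ₊₁ = (x - n c) fₙ and f₀ = 1.  Products of solutions for x and y
-- solve the equation for x + y, which gives the addition formula.  At c = 0 the solution
-- is e^(xt), and by the recursion each coefficient for parameter c is the one for c = 0
-- plus c times a quantity bounded for small c.  Families of the form L + c Q(c) with Q
-- bounded are closed under sums and products, hence each coefficient of the generating
-- function has this form, and its limit is L.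

open import Algebra.Bundles using (CommutativeRing)
open import Algebra.Structures using (IsCommutativeRing)
open import Data.Fin.Base using (Fin; toℕ)
import Data.Fin.Properties as Finₚ
open import Data.Integer.Base as ℤ using (ℤ)
import Data.Integer.Properties as ℤₚ
open import Data.Nat.Base as ℕ using (ℕ; zero; suc; _∸_; _!; _≤_)
open import Data.Nat.Combinatorics using (_C_; nCk≡n!/k![n-k]!; k![n∸k]!∣n!)
open import Data.Nat.DivMod using (m/n*n≡m)
import Data.Nat.Properties as ℕₚ
open import Data.Product.Base using (∃; Σ; _×_; _,_; proj₁; proj₂)
open import Data.Rational.Base as ℚ using (ℚ; 0ℚ; 1ℚ; ½)
import Data.Rational.Properties as ℚₚ
open import Data.Rational.Solver using (module +-*-Solver)
import Data.Rational.Unnormalised.Base as ℚᵘ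
import Data.Rational.Unnormalised.Properties as ℚᵘₚ
open import Data.Sum.Base using (inj₁; inj₂)
open import Function.Base using (_∘_)
open import Level using (0ℓ; _⊔_)
open import Relation.Binary.PropositionalEquality as ≡ using (_≡_)
open import Relation.Nullary.Negation.Core using (¬_)

-- The obstacle to the limit is that the exponents x/c and -1/c are unbounded as c tends to 0, so
-- the factors making up a binomial coefficient have no limits separately. The differential equation
-- hides the quotient: an exponent a enters only through a c ≈ x, and what remains is polynomial in
-- c. The remainder is carried as an explicit family Q with one bound on a fixed square about 0, not
-- as an ε-δ statement. Closure under sums and products then rests on ring identities, and a δ is
-- computed only once, at the very end. The algebra takes place in an arbitrary commutative ring
-- with invertible factorials; Cauchy sequences enter through the ring laws, the inverse,
-- boundedness and that final δ.

nCk*k!*[n∸k]!≡n! : ∀ {n k} → k ≤ n → (n C k) ℕ.* (k ! ℕ.* (n ∸ k) !) ≡ n !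
nCk*k!*[n∸k]!≡n! {n} {k} k≤n =
  ≡.trans (≡.cong (ℕ._* (k ! ℕ.* (n ∸ k) !)) (nCk≡n!/k![n-k]! k≤n))
    (m/n*n≡m {{k ℕₚ.!* (n ∸ k) !≢0}} (k![n∸k]!∣n! k≤n))

-- Power series over a commutative ring.

module PowerSeries {c ℓ} (R : CommutativeRing c ℓ) where

  open CommutativeRing R
  open import Algebra.Properties.Semiring.Exp semiring using (_^_)
  open import Algebra.Properties.AbelianGroup +-abelianGroup using (xyx⁻¹≈y)
  open import Algebra.Properties.Ring ring
    using (-‿distribˡ-*; -‿+-comm; -0#≈0#; -1*x≈-x)
  open import Algebra.Properties.Semiring.Sum semiring
    using (sum; sum-cong-≋; *-distribˡ-sum; ∑-distrib-+)
  open import Algebra.Solver.Ring.NaturalCoefficients.Default commutativeSemiring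
    using (solve; _:=_; _:+_; _:*_; con)
  open import Relation.Binary.Reasoning.Setoid setoid

  inverse-cancelʳ : ∀ x i c → i * c ≈ 1# → x * i * c ≈ x
  inverse-cancelʳ x i c ic≈1 = trans (*-assoc x i c) (trans (*-congˡ ic≈1) (*-identityʳ x))

  neg-inverse : ∀ i c → i * c ≈ 1# → - i * c ≈ - 1#
  neg-inverse i c ic≈1 = trans (sym (-‿distribˡ-* i c)) (-‿cong ic≈1)

  infix  4 _≋_
  infixl 7 _⊛_

  _≋_ : (f g : ℕ → Carrier) → Set ℓ
  f ≋ g = ∀ n → f n ≈ g n

  -- Over the complex numbers this unfolds to `_*ₛ_`, so the laws proved here transfer as they
  -- stand.
  _⊛_ : (f g : ℕ → Carrier) → ℕ → Carrier
  (f ⊛ g) n = sum {suc n} (λ i → f (toℕ i) * g (n ∸ toℕ i))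

  ⊛-cong : ∀ {f f′ g g′} → f ≋ f′ → g ≋ g′ → f ⊛ g ≋ f′ ⊛ g′
  ⊛-cong f≋f′ g≋g′ n = sum-cong-≋ {suc n} (λ i → *-cong (f≋f′ (toℕ i)) (g≋g′ (n ∸ toℕ i)))

  ⊛-congˡ : ∀ f {g g′} → g ≋ g′ → f ⊛ g ≋ f ⊛ g′
  ⊛-congˡ f = ⊛-cong (λ n → refl {f n})

  ⊛-distribʳ-+ : ∀ f g h n → ((λ m → f m + g m) ⊛ h) n ≈ (f ⊛ h) n + (g ⊛ h) n
  ⊛-distribʳ-+ f g h n = trans
    (sum-cong-≋ {suc n} (λ i → distribʳ (h (n ∸ toℕ i)) (f (toℕ i)) (g (toℕ i))))
    (∑-distrib-+ {suc n} (λ i → f (toℕ i) * h (n ∸ toℕ i)) (λ i → g (toℕ i) * h (n ∸ toℕ i)))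

  *-⊛-assoc : ∀ a f g n → ((λ m → a * f m) ⊛ g) n ≈ a * (f ⊛ g) n
  *-⊛-assoc a f g n = trans
    (sum-cong-≋ {suc n} (λ i → *-assoc a (f (toℕ i)) (g (n ∸ toℕ i))))
    (sym (*-distribˡ-sum {suc n} a (λ i → f (toℕ i) * g (n ∸ toℕ i))))

  -- The recursion (f ⊛ g)ₙ₊₁ = f₀ gₙ₊₁ + ((f ∘ suc) ⊛ g)ₙ holds by computation.
  ⊛-assoc : ∀ f g h → (f ⊛ g) ⊛ h ≋ f ⊛ (g ⊛ h)
  ⊛-assoc f g h zero = solve 3
    (λ a b c → (a :* b :+ con 0) :* c :+ con 0 := a :* (b :* c :+ con 0) :+ con 0)
    refl (f 0) (g 0) (h 0)
  ⊛-assoc f g h (suc n) = begin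
    (f 0 * g 0 + 0#) * h (suc n) + ((λ m → f 0 * g (suc m) + (f′ ⊛ g) m) ⊛ h) n
      ≈⟨ +-congˡ (⊛-distribʳ-+ (λ m → f 0 * g (suc m)) (f′ ⊛ g) h n) ⟩
    (f 0 * g 0 + 0#) * h (suc n) + (((λ m → f 0 * g (suc m)) ⊛ h) n + ((f′ ⊛ g) ⊛ h) n)
      ≈⟨ +-congˡ (+-cong (*-⊛-assoc (f 0) (g ∘ suc) h n) (⊛-assoc f′ g h n)) ⟩
    (f 0 * g 0 + 0#) * h (suc n) + (f 0 * ((g ∘ suc) ⊛ h) n + (f′ ⊛ (g ⊛ h)) n)
      ≈⟨ solve 5 (λ a b c d e →
           (a :* b :+ con 0) :* c :+ (a :* d :+ e) := a :* (b :* c :+ d) :+ e)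
         refl (f 0) (g 0) (h (suc n)) (((g ∘ suc) ⊛ h) n) ((f′ ⊛ (g ⊛ h)) n) ⟩
    f 0 * (g 0 * h (suc n) + ((g ∘ suc) ⊛ h) n) + (f′ ⊛ (g ⊛ h)) n ∎
    where
    f′ : ℕ → Carrier
    f′ = f ∘ suc

  -- Unfolding the sum only exposes its first term; the product rule also has to remove the term
  -- with `g 0` at the other end.
  ⊛-last : ∀ f g n → (f ⊛ g) (suc n) ≈ (f ⊛ (g ∘ suc)) n + f (suc n) * g 0
  ⊛-last f g zero = solve 4
    (λ a b c d → a :* b :+ (c :* d :+ con 0) := a :* b :+ con 0 :+ c :* d)
    refl (f 0) (g 1) (f 1) (g 0)
  ⊛-last f g (suc n) = begin
    f 0 * g (2 ℕ.+ n) + ((f ∘ suc) ⊛ g) (suc n)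
      ≈⟨ +-congˡ (⊛-last (f ∘ suc) g n) ⟩
    f 0 * g (2 ℕ.+ n) + (((f ∘ suc) ⊛ (g ∘ suc)) n + f (2 ℕ.+ n) * g 0)
      ≈⟨ +-assoc _ _ _ ⟨
    f 0 * g (2 ℕ.+ n) + ((f ∘ suc) ⊛ (g ∘ suc)) n + f (2 ℕ.+ n) * g 0 ∎

  -- The differential equation of the degenerate exponential.

  module DegenerateExponential
    (ι : ℕ → Carrier)
    (ι-0 : ι 0 ≈ 0#)
    (ι-1 : ι 1 ≈ 1#)
    (ι-+ : ∀ m n → ι (m ℕ.+ n) ≈ ι m + ι n)
    (ι-* : ∀ m n → ι (m ℕ.* n) ≈ ι m * ι n)
    (1/! : ℕ → Carrier)
    (!-inverse : ∀ n → ι (n !) * 1/! n ≈ 1#)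
    (falling : Carrier → ℕ → Carrier)
    (falling-0 : ∀ a → falling a 0 ≈ 1#)
    (falling-suc : ∀ a n → falling a (suc n) ≈ falling a n * (a - ι n))
    where

    binomial : (c a : Carrier) → ℕ → Carrier
    binomial c a n = falling a n * (c ^ n) * 1/! n

    exp : Carrier → ℕ → Carrier
    exp x n = (x ^ n) * 1/! n

    1/!-0 : 1/! 0 ≈ 1#
    1/!-0 = trans (sym (*-identityˡ (1/! 0)))
      (trans (*-congʳ (sym ι-1)) (!-inverse 0))

    1/!-suc : ∀ n → ι (suc n) * 1/! (suc n) ≈ 1/! n
    1/!-suc n = begin
      ι (suc n) * 1/! (suc n)
        ≈⟨ *-identityʳ _ ⟨
      ι (suc n) * 1/! (suc n) * 1#
        ≈⟨ *-congˡ (!-inverse n) ⟨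
      ι (suc n) * 1/! (suc n) * (ι (n !) * 1/! n)
        ≈⟨ solve 4 (λ a b c d → a :* b :* (c :* d) := a :* c :* b :* d) refl _ _ _ _ ⟩
      ι (suc n) * ι (n !) * 1/! (suc n) * 1/! n
        ≈⟨ *-congʳ (*-congʳ (ι-* (suc n) (n !))) ⟨
      ι (suc n !) * 1/! (suc n) * 1/! n
        ≈⟨ *-congʳ (!-inverse (suc n)) ⟩
      1# * 1/! n
        ≈⟨ *-identityˡ _ ⟩
      1/! n ∎

    -- The reciprocal of n + 1 is written as n!/(n+1)!, since reciprocal factorials are the only
    -- division at hand.
    ι-suc-inverse : ∀ n → (1/! (suc n) * ι (n !)) * ι (suc n) ≈ 1#
    ι-suc-inverse n = begin
      1/! (suc n) * ι (n !) * ι (suc n)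
        ≈⟨ solve 3 (λ a b c → a :* b :* c := (c :* b) :* a) refl _ _ _ ⟩
      (ι (suc n) * ι (n !)) * 1/! (suc n)
        ≈⟨ *-congʳ (ι-* (suc n) (n !)) ⟨
      ι (suc n !) * 1/! (suc n)
        ≈⟨ !-inverse (suc n) ⟩
      1# ∎

    -- The differential equation (1 + c t) f′ = x f, f(0) = 1 of (1 + c t)^(x/c),
    -- which makes sense for c = 0 as well.
    record IsDegenerateExp (c x : Carrier) (f : ℕ → Carrier) : Set ℓ where
      field
        initial : f 0 ≈ 1#
        step    : ∀ n → ι (suc n) * f (suc n) ≈ (x - ι n * c) * f n

    open IsDegenerateExp

    -- Dividing by n + 1 makes the equation an explicit recursion whose leading scalar does not
    -- depend on c. Uniqueness and the comparison with c = 0 are both inductions along it.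
    solve-step : ∀ {c x f} → IsDegenerateExp c x f → ∀ n →
      f (suc n) ≈ (1/! (suc n) * ι (n !)) * ((x - ι n * c) * f n)
    solve-step {c} {x} {f} p n = begin
      f (suc n)
        ≈⟨ *-identityˡ _ ⟨
      1# * f (suc n)
        ≈⟨ *-congʳ (ι-suc-inverse n) ⟨
      (1/! (suc n) * ι (n !)) * ι (suc n) * f (suc n)
        ≈⟨ *-assoc _ _ _ ⟩
      (1/! (suc n) * ι (n !)) * (ι (suc n) * f (suc n))
        ≈⟨ *-congˡ (step p n) ⟩
      (1/! (suc n) * ι (n !)) * ((x - ι n * c) * f n) ∎

    isDegenerateExp-unique : ∀ {c x f g} →
      IsDegenerateExp c x f → IsDegenerateExp c x g → f ≋ g
    isDegenerateExp-unique p q zero    = trans (initial p) (sym (initial q))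
    isDegenerateExp-unique p q (suc n) = trans (solve-step p n)
      (trans (*-congˡ (*-congˡ (isDegenerateExp-unique p q n))) (sym (solve-step q n)))

    -- Multiplying the n-th coefficient by n is the operator t d/dt. It is a derivation because n =
    -- i + (n - i) in each term of the convolution.
    ⊛-leibniz : ∀ f g n → ι n * (f ⊛ g) n ≈
      ((λ m → ι m * f m) ⊛ g) n + (f ⊛ (λ m → ι m * g m)) n
    ⊛-leibniz f g n = begin
      ι n * (f ⊛ g) n
        ≈⟨ *-distribˡ-sum {suc n} (ι n) (λ i → f (toℕ i) * g (n ∸ toℕ i)) ⟩
      sum {suc n} (λ i → ι n * (f (toℕ i) * g (n ∸ toℕ i)))
        ≈⟨ sum-cong-≋ {suc n} term ⟩
      sum {suc n} (λ i → ι (toℕ i) * f (toℕ i) * g (n ∸ toℕ i)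
                       + f (toℕ i) * (ι (n ∸ toℕ i) * g (n ∸ toℕ i)))
        ≈⟨ ∑-distrib-+ {suc n} (λ i → ι (toℕ i) * f (toℕ i) * g (n ∸ toℕ i))
             (λ i → f (toℕ i) * (ι (n ∸ toℕ i) * g (n ∸ toℕ i))) ⟩
      ((λ m → ι m * f m) ⊛ g) n + (f ⊛ (λ m → ι m * g m)) n ∎
      where
      term : (i : Fin (suc n)) → ι n * (f (toℕ i) * g (n ∸ toℕ i)) ≈
        ι (toℕ i) * f (toℕ i) * g (n ∸ toℕ i) + f (toℕ i) * (ι (n ∸ toℕ i) * g (n ∸ toℕ i))
      term i = begin
        ι n * (f k * g (n ∸ k))
          ≡⟨ ≡.cong (λ v → ι v * (f k * g (n ∸ k))) (ℕₚ.m+[n∸m]≡n (Finₚ.toℕ≤pred[n] i)) ⟨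
        ι (k ℕ.+ (n ∸ k)) * (f k * g (n ∸ k))
          ≈⟨ *-congʳ (ι-+ k (n ∸ k)) ⟩
        (ι k + ι (n ∸ k)) * (f k * g (n ∸ k))
          ≈⟨ solve 4 (λ a b u v → (a :+ b) :* (u :* v) := a :* u :* v :+ u :* (b :* v)) refl _ _ _ _ ⟩
        ι k * f k * g (n ∸ k) + f k * (ι (n ∸ k) * g (n ∸ k)) ∎
        where
        k : ℕ
        k = toℕ i

    -- The terms at k and l = n - k contribute (x - k c) + (y - l c) = x + y - n c, a factor free of
    -- k that comes out of the sum. Using t d/dt in degree n + 1 instead of d/dt in degree n lets
    -- the product rule apply without shifting indices.
    ⊛-isDegenerateExp : ∀ {c x y f g} → IsDegenerateExp c x f →
      IsDegenerateExp c y g → IsDegenerateExp c (x + y) (f ⊛ g)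
    ⊛-isDegenerateExp {c} {x} {y} {f} {g} p q = record
      { initial = trans (+-identityʳ _) (trans (*-cong (initial p) (initial q)) (*-identityˡ 1#))
      ; step    = leibniz
      }
      where
      θf θg : ℕ → Carrier
      θf m = ι m * f m
      θg m = ι m * g m

      term : ∀ n k → k ≤ n →
        θf (suc k) * g (n ∸ k) + f k * θg (suc (n ∸ k)) ≈
        (x + y - ι n * c) * (f k * g (n ∸ k))
      term n k k≤n = begin
        θf (suc k) * g l + f k * θg (suc l)
          ≈⟨ +-cong (*-congʳ (step p k)) (*-congˡ (step q l)) ⟩
        (x - ι k * c) * f k * g l + f k * ((y - ι l * c) * g l)
          -- With the sign moved onto `ι k` and `ι l`, the next identity has natural coefficients in
          -- these negatives.
          ≈⟨ +-cong (*-congʳ (*-congʳ (+-congˡ (-‿distribˡ-* (ι k) c))))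
                    (*-congˡ (*-congʳ (+-congˡ (-‿distribˡ-* (ι l) c)))) ⟩
        (x + - ι k * c) * f k * g l + f k * ((y + - ι l * c) * g l)
          ≈⟨ solve 7 (λ x y a b c u v →
               (x :+ a :* c) :* u :* v :+ u :* ((y :+ b :* c) :* v) :=
               (x :+ y :+ (a :+ b) :* c) :* (u :* v))
             refl x y (- ι k) (- ι l) c (f k) (g l) ⟩
        (x + y + (- ι k + - ι l) * c) * (f k * g l)
          ≈⟨ *-congʳ (+-congˡ (*-congʳ (-‿+-comm (ι k) (ι l)))) ⟩
        (x + y + - (ι k + ι l) * c) * (f k * g l)
          ≈⟨ *-congʳ (+-congˡ (*-congʳ (-‿cong (ι-+ k l)))) ⟨
        (x + y + - ι (k ℕ.+ l) * c) * (f k * g l)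
          ≡⟨ ≡.cong (λ v → (x + y + - ι v * c) * (f k * g l)) (ℕₚ.m+[n∸m]≡n k≤n) ⟩
        (x + y + - ι n * c) * (f k * g l)
          ≈⟨ *-congʳ (+-congˡ (-‿distribˡ-* (ι n) c)) ⟨
        (x + y - ι n * c) * (f k * g l) ∎
        where
        l : ℕ
        l = n ∸ k

      leibniz : ∀ n → ι (suc n) * (f ⊛ g) (suc n) ≈ (x + y - ι n * c) * (f ⊛ g) n
      leibniz n = begin
        ι (suc n) * (f ⊛ g) (suc n)
          ≈⟨ ⊛-leibniz f g (suc n) ⟩
        (ι 0 * f 0 * g (suc n) + ((θf ∘ suc) ⊛ g) n) + (f ⊛ θg) (suc n)
          -- One boundary term is split off each convolution, the first for `θf` and the last for
          -- `θg`; both contain `ι 0` and vanish.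
          ≈⟨ +-cong (+-congʳ (*-congʳ (*-congʳ ι-0))) (⊛-last f θg n) ⟩
        (0# * f 0 * g (suc n) + ((θf ∘ suc) ⊛ g) n) + ((f ⊛ (θg ∘ suc)) n + f (suc n) * (ι 0 * g 0))
          ≈⟨ +-congˡ (+-congˡ (*-congˡ (*-congʳ ι-0))) ⟩
        (0# * f 0 * g (suc n) + ((θf ∘ suc) ⊛ g) n) + ((f ⊛ (θg ∘ suc)) n + f (suc n) * (0# * g 0))
          ≈⟨ solve 6 (λ a b c d u v →
               (con 0 :* a :* b :+ u) :+ (v :+ c :* (con 0 :* d)) := u :+ v)
             refl (f 0) (g (suc n)) (f (suc n)) (g 0)
             (((θf ∘ suc) ⊛ g) n) ((f ⊛ (θg ∘ suc)) n) ⟩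
        ((θf ∘ suc) ⊛ g) n + (f ⊛ (θg ∘ suc)) n
          ≈⟨ ∑-distrib-+ {suc n} (λ i → θf (suc (toℕ i)) * g (n ∸ toℕ i))
               (λ i → f (toℕ i) * θg (suc (n ∸ toℕ i))) ⟨
        sum {suc n} (λ i → θf (suc (toℕ i)) * g (n ∸ toℕ i) + f (toℕ i) * θg (suc (n ∸ toℕ i)))
          ≈⟨ sum-cong-≋ {suc n} (λ i → term n (toℕ i) (Finₚ.toℕ≤pred[n] i)) ⟩
        sum {suc n} (λ i → (x + y - ι n * c) * (f (toℕ i) * g (n ∸ toℕ i)))
          ≈⟨ *-distribˡ-sum {suc n} (x + y - ι n * c) (λ i → f (toℕ i) * g (n ∸ toℕ i)) ⟨
        (x + y - ι n * c) * (f ⊛ g) n ∎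

    -- The new factor a - n of the falling factorial is paired with the new factor c of the power:
    -- (a - n) c = x - n c.
    binomial-isDegenerateExp : ∀ {a c x} → a * c ≈ x → IsDegenerateExp c x (binomial c a)
    binomial-isDegenerateExp {a} {c} {x} ac≈x = record
      { initial = trans (*-cong (*-congʳ (falling-0 a)) 1/!-0)
          (solve 0 (con 1 :* con 1 :* con 1 := con 1) refl)
      ; step    = λ n → begin
          ι (suc n) * (falling a (suc n) * (c * (c ^ n)) * 1/! (suc n))
            ≈⟨ *-congˡ (*-congʳ (*-congʳ (falling-suc a n))) ⟩
          ι (suc n) * (falling a n * (a - ι n) * (c * (c ^ n)) * 1/! (suc n))
            ≈⟨ solve 7 (λ i f a j c d e →
                 i :* (f :* (a :+ j) :* (c :* d) :* e) :=
                 (a :* c :+ j :* c) :* (f :* d :* (i :* e)))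
               refl (ι (suc n)) (falling a n) a (- ι n) c (c ^ n) (1/! (suc n)) ⟩
          (a * c + - ι n * c) * (falling a n * (c ^ n) * (ι (suc n) * 1/! (suc n)))
            ≈⟨ *-cong (+-cong ac≈x (sym (-‿distribˡ-* (ι n) c))) (*-congˡ (1/!-suc n)) ⟩
          (x - ι n * c) * binomial c a n ∎
      }

    exp-isDegenerateExp : ∀ x → IsDegenerateExp 0# x (exp x)
    exp-isDegenerateExp x = record
      { initial = trans (*-identityˡ _) 1/!-0
      ; step    = λ n → begin
          ι (suc n) * (x * (x ^ n) * 1/! (suc n))
            ≈⟨ solve 4 (λ i x d e → i :* (x :* d :* e) := x :* (d :* (i :* e))) refl _ _ _ _ ⟩
          x * ((x ^ n) * (ι (suc n) * 1/! (suc n)))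
            ≈⟨ *-cong (x≈ n) (*-congˡ (1/!-suc n)) ⟩
          (x - ι n * 0#) * exp x n ∎
      }
      where
      x≈ : ∀ n → x ≈ x - ι n * 0#
      x≈ n = sym (trans (+-congˡ (trans (-‿cong (zeroʳ (ι n))) -0#≈0#)) (+-identityʳ x))

    -- Split n! as C(n,k) k! (n-k)!: the factor k! turns `f k` into an exponential coefficient, and
    -- (n-k)! cancels the denominator of the binomial series.
    binomial-convolution : ∀ f c a n →
      ι (n !) * (f ⊛ binomial c a) n ≈
      sum {suc n} (λ i → ι (n C toℕ i) * falling a (n ∸ toℕ i) * (c ^ (n ∸ toℕ i))
                           * (ι (toℕ i !) * f (toℕ i)))
    binomial-convolution f c a n = trans
      (*-distribˡ-sum {suc n} (ι (n !)) (λ i → f (toℕ i) * binomial c a (n ∸ toℕ i)))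
      (sum-cong-≋ {suc n} (λ i → term (toℕ i) (Finₚ.toℕ≤pred[n] i)))
      where
      term : ∀ k → k ≤ n → ι (n !) * (f k * binomial c a (n ∸ k)) ≈
        ι (n C k) * falling a (n ∸ k) * (c ^ (n ∸ k)) * (ι (k !) * f k)
      term k k≤n = begin
        ι (n !) * (f k * binomial c a l)
          ≡⟨ ≡.cong (λ v → ι v * (f k * binomial c a l)) (nCk*k!*[n∸k]!≡n! k≤n) ⟨
        ι ((n C k) ℕ.* (k ! ℕ.* l !)) * (f k * binomial c a l)
          ≈⟨ *-congʳ (trans (ι-* (n C k) (k ! ℕ.* l !)) (*-congˡ (ι-* (k !) (l !)))) ⟩
        (ι (n C k) * (ι (k !) * ι (l !))) * (f k * binomial c a l)
          ≈⟨ solve 7 (λ a b d u v w e →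
               (a :* (b :* d)) :* (u :* (v :* w :* e)) := a :* v :* w :* (b :* u) :* (d :* e))
             refl (ι (n C k)) (ι (k !)) (ι (l !)) (f k) (falling a l) (c ^ l) (1/! l) ⟩
        ι (n C k) * falling a l * (c ^ l) * (ι (k !) * f k) * (ι (l !) * 1/! l)
          ≈⟨ *-congˡ (!-inverse l) ⟩
        ι (n C k) * falling a l * (c ^ l) * (ι (k !) * f k) * 1#
          ≈⟨ *-identityʳ _ ⟩
        ι (n C k) * falling a l * (c ^ l) * (ι (k !) * f k) ∎
        where
        l : ℕ
        l = n ∸ k

    -- First-order expansions with bounded remainder.

    module Estimates {i p} {I : Set i} (z : I → Carrier)
      (Bounded : (I → Carrier) → Set p)
      (const-bounded : ∀ a → Bounded (λ _ → a))
      (z-bounded : Bounded z)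
      (+-bounded : ∀ F G → Bounded F → Bounded G → Bounded (λ j → F j + G j))
      (*-bounded : ∀ F G → Bounded F → Bounded G → Bounded (λ j → F j * G j))
      where

      infix 4 _∼_

      -- F = L + O(z)
      record _∼_ (F : I → Carrier) (L : Carrier) : Set (c ⊔ ℓ ⊔ i ⊔ p) where
        constructor remainder
        field
          quotient         : I → Carrier
          quotient-bounded : Bounded quotient
          expansion        : ∀ j → F j ≈ L + z j * quotient j

      difference : ∀ {F L} (F∼L : F ∼ L) j → F j - L ≈ z j * _∼_.quotient F∼L j
      difference {L = L} (remainder Q b e) j =
        trans (+-congʳ (e j)) (xyx⁻¹≈y L (z j * Q j))

      const-∼ : ∀ a → (λ _ → a) ∼ a
      const-∼ a = remainder (λ _ → 0#) (const-bounded 0#)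
        (λ j → sym (trans (+-congˡ (zeroʳ (z j))) (+-identityʳ a)))

      z-∼ : z ∼ 0#
      z-∼ = remainder (λ _ → 1#) (const-bounded 1#)
        (λ j → sym (trans (+-identityˡ _) (*-identityʳ (z j))))

      ∼-resp-≈ : ∀ {F G L M} → (∀ j → F j ≈ G j) → L ≈ M → F ∼ L → G ∼ M
      ∼-resp-≈ F≈G L≈M (remainder Q b e) =
        remainder Q b (λ j → trans (sym (F≈G j)) (trans (e j) (+-congʳ L≈M)))

      +-∼ : ∀ {F G L M} → F ∼ L → G ∼ M → (λ j → F j + G j) ∼ (L + M)
      +-∼ {L = L} {M} (remainder Q b e) (remainder S d h) = remainder (λ j → Q j + S j)
        (+-bounded Q S b d)
        (λ j → trans (+-cong (e j) (h j))
          (solve 5 (λ l m z q s → (l :+ z :* q) :+ (m :+ z :* s) := l :+ m :+ z :* (q :+ s))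
            refl L M (z j) (Q j) (S j)))

      *-∼ : ∀ {F G L M} → F ∼ L → G ∼ M → (λ j → F j * G j) ∼ (L * M)
      *-∼ {L = L} {M} (remainder Q b e) (remainder S d h) = remainder
        -- Read off from (L + zQ)(M + zS) = LM + z(LS + Q(M + zS)). The inner zS is where
        -- boundedness of z itself comes in.
        (λ j → L * S j + Q j * (M + z j * S j))
        (+-bounded (λ j → L * S j) (λ j → Q j * (M + z j * S j))
          (*-bounded (λ _ → L) S (const-bounded L) d)
          (*-bounded Q (λ j → M + z j * S j) b
            (+-bounded (λ _ → M) (λ j → z j * S j) (const-bounded M) (*-bounded z S z-bounded d))))
        (λ j → trans (*-cong (e j) (h j))
          (solve 5 (λ l m z q s → (l :+ z :* q) :* (m :+ z :* s) :=
              l :* m :+ z :* (l :* s :+ q :* (m :+ z :* s)))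
            refl L M (z j) (Q j) (S j)))

      -- Negation is multiplication by -1, so closure of `Bounded` under products covers it.
      -‿∼ : ∀ {F L} → F ∼ L → (λ j → - F j) ∼ (- L)
      -‿∼ {F} {L} F∼L = ∼-resp-≈ (λ j → -1*x≈-x (F j)) (-1*x≈-x L) (*-∼ (const-∼ (- 1#)) F∼L)

      sum-∼ : ∀ n (F : I → Fin n → Carrier) (L : Fin n → Carrier) →
        (∀ k → (λ j → F j k) ∼ L k) → (λ j → sum (F j)) ∼ sum L
      sum-∼ zero    F L F∼L = const-∼ 0#
      sum-∼ (suc n) F L F∼L = +-∼ (F∼L Fin.zero)
        (sum-∼ n (λ j → F j ∘ Fin.suc) (L ∘ Fin.suc) (F∼L ∘ Fin.suc))

      ⊛-∼ : ∀ (F G : I → ℕ → Carrier) (f g : ℕ → Carrier) →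
        (∀ n → (λ j → F j n) ∼ f n) → (∀ n → (λ j → G j n) ∼ g n) →
        ∀ n → (λ j → (F j ⊛ G j) n) ∼ (f ⊛ g) n
      ⊛-∼ F G f g F∼f G∼g n = sum-∼ (suc n) (λ j k → F j (toℕ k) * G j (n ∸ toℕ k))
        (λ k → f (toℕ k) * g (n ∸ toℕ k)) (λ k → *-∼ (F∼f (toℕ k)) (G∼g (n ∸ toℕ k)))

      -- Induction along `solve-step`: its scalar is the same for every z, and x - n z = x + O(z),
      -- so each new coefficient is a product of three expansions. There is no division by z.
      isDegenerateExp-∼ : ∀ {x} (F : I → ℕ → Carrier) (f : ℕ → Carrier) →
        (∀ j → IsDegenerateExp (z j) x (F j)) → IsDegenerateExp 0# x f →
        ∀ n → (λ j → F j n) ∼ f n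
      isDegenerateExp-∼ F f isF isf zero =
        ∼-resp-≈ (λ j → sym (initial (isF j))) (sym (initial isf)) (const-∼ 1#)
      isDegenerateExp-∼ {x} F f isF isf (suc n) =
        ∼-resp-≈ (λ j → sym (solve-step (isF j) n)) (sym (solve-step isf n))
          (*-∼ (const-∼ _)
            (*-∼ (+-∼ (const-∼ x) (-‿∼ (*-∼ (const-∼ (ι n)) z-∼)))
                 (isDegenerateExp-∼ F f isF isf n)))

      binomial-∼-exp : ∀ x (a : I → Carrier) → (∀ j → a j * z j ≈ x) →
        ∀ n → (λ j → binomial (z j) (a j) n) ∼ exp x n
      binomial-∼-exp x a az≈x = isDegenerateExp-∼ (λ j → binomial (z j) (a j)) (exp x)
        (λ j → binomial-isDegenerateExp (az≈x j)) (exp-isDegenerateExp x)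

open import Defs

-- Inequalities between rationals.

half-pos : ∀ {ε} → 0ℚ ℚ.< ε → 0ℚ ℚ.< ½ ℚ.* ε
half-pos = *-pos (ℚₚ.positive⁻¹ ½)

half+half : ∀ ε → ½ ℚ.* ε ℚ.+ ½ ℚ.* ε ≡ ε
half+half ε = ≡.trans (≡.sym (ℚₚ.*-distribʳ-+ ε ½ ½)) (ℚₚ.*-identityˡ ε)

∣∣-+-< : ∀ {p q a b} → ℚ.∣ p ∣ ℚ.< a → ℚ.∣ q ∣ ℚ.< b → ℚ.∣ p ℚ.+ q ∣ ℚ.< a ℚ.+ b
∣∣-+-< {p} {q} p<a q<b = ℚₚ.≤-<-trans (ℚₚ.∣p+q∣≤∣p∣+∣q∣ p q) (ℚₚ.+-mono-< p<a q<b)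

∣∣-neg-< : ∀ {p a} → ℚ.∣ p ∣ ℚ.< a → ℚ.∣ ℚ.- p ∣ ℚ.< a
∣∣-neg-< {p} {a} = ≡.subst (ℚ._< a) (≡.sym (ℚₚ.∣-p∣≡∣p∣ p))

∣p∣*∣p∣≡p*p : ∀ p → ℚ.∣ p ∣ ℚ.* ℚ.∣ p ∣ ≡ p ℚ.* p
∣p∣*∣p∣≡p*p p with ℚₚ.∣p∣≡p∨∣p∣≡-p p
... | inj₁ eq = ≡.cong₂ ℚ._*_ eq eq
... | inj₂ eq = ≡.trans (≡.cong₂ ℚ._*_ eq eq)
  (solve 1 (λ p → (:- p) :* (:- p) := p :* p) ≡.refl p)
  where open +-*-Solver

0≤p*p : ∀ p → 0ℚ ℚ.≤ p ℚ.* p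
0≤p*p p = ≡.subst (0ℚ ℚ.≤_) (≡.trans (ℚₚ.∣p*q∣≡∣p∣*∣q∣ p p) (∣p∣*∣p∣≡p*p p)) (ℚₚ.0≤∣p∣ (p ℚ.* p))

square-mono-≤ : ∀ {p q} → 0ℚ ℚ.≤ p → p ℚ.≤ q → p ℚ.* p ℚ.≤ q ℚ.* q
square-mono-≤ {p} {q} 0≤p p≤q = ℚₚ.≤-trans
  (ℚₚ.*-monoˡ-≤-nonNeg p {{ℚ.nonNegative 0≤p}} p≤q)
  (ℚₚ.*-monoʳ-≤-nonNeg q {{ℚ.nonNegative (ℚₚ.≤-trans 0≤p p≤q)}} p≤q)

square-mono-< : ∀ {p q} → 0ℚ ℚ.≤ p → p ℚ.< q → p ℚ.* p ℚ.< q ℚ.* q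
square-mono-< {p} {q} 0≤p p<q = ℚₚ.≤-<-trans
  (ℚₚ.*-monoˡ-≤-nonNeg p {{ℚ.nonNegative 0≤p}} (ℚₚ.<⇒≤ p<q))
  (ℚₚ.*-monoˡ-<-pos q {{ℚ.positive (ℚₚ.≤-<-trans 0≤p p<q)}} p<q)

square-cancel-< : ∀ {p q} → 0ℚ ℚ.< q → p ℚ.* p ℚ.< q ℚ.* q → ℚ.∣ p ∣ ℚ.< q
square-cancel-< {p} {q} 0<q pp<qq = ℚₚ.≰⇒> λ q≤∣p∣ → ℚₚ.<-irrefl ≡.refl
  (ℚₚ.<-≤-trans pp<qq (≡.subst (q ℚ.* q ℚ.≤_) (∣p∣*∣p∣≡p*p p) (square-mono-≤ (ℚₚ.<⇒≤ 0<q) q≤∣p∣)))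

-- This and the next lemma pass between plain rational inequalities and the gap form in which `_<ℝ_`
-- is stated: one creates a gap, the other discards it.
p+q<r⇒p<r-q : ∀ p q r → p ℚ.+ q ℚ.< r → p ℚ.< r ℚ.- q
p+q<r⇒p<r-q p q r p+q<r = ≡.subst (ℚ._< r ℚ.- q)
  (solve 2 (λ p q → p :+ q :- q := p) ≡.refl p q) (ℚₚ.+-monoˡ-< (ℚ.- q) p+q<r)
  where open +-*-Solver

0<p<r-q⇒q<r : ∀ p q r → 0ℚ ℚ.< p → p ℚ.< r ℚ.- q → q ℚ.< r
0<p<r-q⇒q<r p q r 0<p p<r-q = ≡.subst₂ ℚ._<_ (ℚₚ.+-identityˡ q)
  (solve 2 (λ q r → r :- q :+ q := r) ≡.refl q r) (ℚₚ.+-monoˡ-< q (ℚₚ.<-trans 0<p p<r-q))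
  where open +-*-Solver

-- Equality and arithmetic of Cauchy reals.

-- The threshold `N` is there for inverses, where early terms may carry the default value of
-- `recip`.
eventually-≡⇒≃ℝ : ∀ {x y} N → (∀ n → N ℕ.≤ n → seq x n ≡ seq y n) → x ≃ℝ y
eventually-≡⇒≃ℝ {x} {y} N x≡y ε 0<ε = N , λ n N≤n → ≡.subst (λ v → ℚ.∣ v ℚ.- seq y n ∣ ℚ.< ε)
  (≡.sym (x≡y n N≤n))
  (≡.subst (ℚ._< ε) (≡.sym (≡.cong ℚ.∣_∣ (ℚₚ.+-inverseʳ (seq y n)))) 0<ε)

≗⇒≃ℝ : ∀ {x y} → (∀ n → seq x n ≡ seq y n) → x ≃ℝ y
≗⇒≃ℝ {x} {y} x≡y = eventually-≡⇒≃ℝ {x} {y} 0 (λ n _ → x≡y n)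

≃ℝ-sym : ∀ {x y} → x ≃ℝ y → y ≃ℝ x
≃ℝ-sym {x} {y} x≃y ε 0<ε with x≃y ε 0<ε
... | N , close = N , λ n N≤n → ≡.subst (λ v → ℚ.∣ v ∣ ℚ.< ε)
  (solve 2 (λ a b → :- (a :- b) := b :- a) ≡.refl (seq x n) (seq y n))
  (∣∣-neg-< {seq x n ℚ.- seq y n} (close n N≤n))
  where open +-*-Solver

≃ℝ-trans : ∀ {x y z} → x ≃ℝ y → y ≃ℝ z → x ≃ℝ z
≃ℝ-trans {x} {y} {z} x≃y y≃z ε 0<ε
  with x≃y (½ ℚ.* ε) (half-pos 0<ε) | y≃z (½ ℚ.* ε) (half-pos 0<ε)
... | M , p | N , q = M ℕ.⊔ N , λ n M⊔N≤n → ≡.subst₂ (λ v w → ℚ.∣ v ∣ ℚ.< w)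
  (solve 3 (λ a b c → (a :- b) :+ (b :- c) := a :- c) ≡.refl (seq x n) (seq y n) (seq z n))
  (half+half ε)
  (∣∣-+-< {seq x n ℚ.- seq y n} (p n (ℕₚ.m⊔n≤o⇒m≤o M N M⊔N≤n)) (q n (ℕₚ.m⊔n≤o⇒n≤o M N M⊔N≤n)))
  where open +-*-Solver

+ℝ-cong : ∀ {x y u v} → x ≃ℝ y → u ≃ℝ v → x +ℝ u ≃ℝ y +ℝ v
+ℝ-cong {x} {y} {u} {v} x≃y u≃v ε 0<ε
  with x≃y (½ ℚ.* ε) (half-pos 0<ε) | u≃v (½ ℚ.* ε) (half-pos 0<ε)
... | M , p | N , q = M ℕ.⊔ N , λ n M⊔N≤n → ≡.subst₂ (λ v w → ℚ.∣ v ∣ ℚ.< w)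
  (≡.sym (addAux (seq x n) (seq u n) (seq y n) (seq v n)))
  (half+half ε)
  (∣∣-+-< {seq x n ℚ.- seq y n} (p n (ℕₚ.m⊔n≤o⇒m≤o M N M⊔N≤n)) (q n (ℕₚ.m⊔n≤o⇒n≤o M N M⊔N≤n)))

-ℝ-cong : ∀ {x y} → x ≃ℝ y → -ℝ x ≃ℝ -ℝ y
-ℝ-cong {x} {y} x≃y ε 0<ε with x≃y ε 0<ε
... | N , close = N , λ n N≤n → ≡.subst (λ v → ℚ.∣ v ∣ ℚ.< ε)
  (≡.sym (negAux (seq x n) (seq y n)))
  (∣∣-neg-< {seq x n ℚ.- seq y n} (close n N≤n))

*ℝ-cong : ∀ {x y u v} → x ≃ℝ y → u ≃ℝ v → x *ℝ u ≃ℝ y *ℝ v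
*ℝ-cong {x} {y} {u} {v} x≃y u≃v ε 0<ε =
  -- Since xu - yv = x(u - v) + v(x - y), only x and v have to be bounded.
  let B , 0<B , M₁ , x<B = bounded {seq x} (cauchy x)
      D , 0<D , M₂ , v<D = bounded {seq v} (cauchy v)
      δ , 0<δ , eq       = divide (B ℚ.+ D) ε (ℚₚ.+-mono-< 0<B 0<D) 0<ε
      N₁ , p             = x≃y δ 0<δ
      N₂ , q             = u≃v δ 0<δ
  in (M₁ ℕ.⊔ M₂) ℕ.⊔ (N₁ ℕ.⊔ N₂) , λ n r →
    let rM = ℕₚ.m⊔n≤o⇒m≤o (M₁ ℕ.⊔ M₂) (N₁ ℕ.⊔ N₂) r
        rN = ℕₚ.m⊔n≤o⇒n≤o (M₁ ℕ.⊔ M₂) (N₁ ℕ.⊔ N₂) r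
    in *-diff (seq x n) (seq u n) (seq y n) (seq v n)
         (x<B n (ℕₚ.m⊔n≤o⇒m≤o M₁ M₂ rM)) (v<D n (ℕₚ.m⊔n≤o⇒n≤o M₁ M₂ rM))
         (p n (ℕₚ.m⊔n≤o⇒m≤o N₁ N₂ rN)) (q n (ℕₚ.m⊔n≤o⇒n≤o N₁ N₂ rN)) eq

-- The complex numbers as a commutative ring.

-- The operations act termwise on approximations, so polynomial identities between rationals yield
-- the ring laws without any estimate.
≃-componentwise : ∀ {z w} → (∀ n → seq (re z) n ≡ seq (re w) n) →
  (∀ n → seq (im z) n ≡ seq (im w) n) → z ≃ w
≃-componentwise {z} {w} p q = ≗⇒≃ℝ {re z} {re w} p , ≗⇒≃ℝ {im z} {im w} q

+-cong : ∀ {z z′ w w′} → z ≃ z′ → w ≃ w′ → z + w ≃ z′ + w′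
+-cong {z} {z′} {w} {w′} (p , q) (r , s) =
  +ℝ-cong {re z} {re z′} {re w} {re w′} p r , +ℝ-cong {im z} {im z′} {im w} {im w′} q s

-‿cong : ∀ {z w} → z ≃ w → - z ≃ - w
-‿cong {z} {w} (p , q) = -ℝ-cong {re z} {re w} p , -ℝ-cong {im z} {im w} q

*-cong : ∀ {z z′ w w′} → z ≃ z′ → w ≃ w′ → z * w ≃ z′ * w′
*-cong {z} {z′} {w} {w′} (p , q) (r , s) =
  +ℝ-cong {re z *ℝ re w} {re z′ *ℝ re w′} { -ℝ (im z *ℝ im w)} { -ℝ (im z′ *ℝ im w′)}
    (*ℝ-cong {re z} {re z′} {re w} {re w′} p r)
    (-ℝ-cong {im z *ℝ im w} {im z′ *ℝ im w′} (*ℝ-cong {im z} {im z′} {im w} {im w′} q s)) ,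
  +ℝ-cong {re z *ℝ im w} {re z′ *ℝ im w′} {im z *ℝ re w} {im z′ *ℝ re w′}
    (*ℝ-cong {re z} {re z′} {im w} {im w′} p s)
    (*ℝ-cong {im z} {im z′} {re w} {re w′} q r)

+-assoc : ∀ z w u → z + w + u ≃ z + (w + u)
+-assoc z w u = ≃-componentwise {z + w + u} {z + (w + u)}
  (λ n → ℚₚ.+-assoc (seq (re z) n) (seq (re w) n) (seq (re u) n))
  (λ n → ℚₚ.+-assoc (seq (im z) n) (seq (im w) n) (seq (im u) n))

+-comm : ∀ z w → z + w ≃ w + z
+-comm z w = ≃-componentwise {z + w} {w + z}
  (λ n → ℚₚ.+-comm (seq (re z) n) (seq (re w) n))
  (λ n → ℚₚ.+-comm (seq (im z) n) (seq (im w) n))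

+-identityˡ : ∀ z → 0ℂ + z ≃ z
+-identityˡ z = ≃-componentwise {0ℂ + z} {z}
  (λ n → ℚₚ.+-identityˡ (seq (re z) n)) (λ n → ℚₚ.+-identityˡ (seq (im z) n))

+-identityʳ : ∀ z → z + 0ℂ ≃ z
+-identityʳ z = ≃-componentwise {z + 0ℂ} {z}
  (λ n → ℚₚ.+-identityʳ (seq (re z) n)) (λ n → ℚₚ.+-identityʳ (seq (im z) n))

+-inverseˡ : ∀ z → (- z) + z ≃ 0ℂ
+-inverseˡ z = ≃-componentwise { (- z) + z} {0ℂ}
  (λ n → ℚₚ.+-inverseˡ (seq (re z) n)) (λ n → ℚₚ.+-inverseˡ (seq (im z) n))

+-inverseʳ : ∀ z → z + (- z) ≃ 0ℂ
+-inverseʳ z = ≃-componentwise {z + (- z)} {0ℂ}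
  (λ n → ℚₚ.+-inverseʳ (seq (re z) n)) (λ n → ℚₚ.+-inverseʳ (seq (im z) n))

*-assoc : ∀ z w u → z * w * u ≃ z * (w * u)
*-assoc z w u = ≃-componentwise {z * w * u} {z * (w * u)}
  (λ n → solve 6 (λ a b c d e f →
      (a :* c :- b :* d) :* e :- (a :* d :+ b :* c) :* f :=
      a :* (c :* e :- d :* f) :- b :* (c :* f :+ d :* e)) ≡.refl
    (seq (re z) n) (seq (im z) n) (seq (re w) n) (seq (im w) n) (seq (re u) n) (seq (im u) n))
  (λ n → solve 6 (λ a b c d e f →
      (a :* c :- b :* d) :* f :+ (a :* d :+ b :* c) :* e :=
      a :* (c :* f :+ d :* e) :+ b :* (c :* e :- d :* f)) ≡.refl
    (seq (re z) n) (seq (im z) n) (seq (re w) n) (seq (im w) n) (seq (re u) n) (seq (im u) n))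
  where open +-*-Solver

*-comm : ∀ z w → z * w ≃ w * z
*-comm z w = ≃-componentwise {z * w} {w * z}
  (λ n → solve 4 (λ a b c d → a :* c :- b :* d := c :* a :- d :* b) ≡.refl
    (seq (re z) n) (seq (im z) n) (seq (re w) n) (seq (im w) n))
  (λ n → solve 4 (λ a b c d → a :* d :+ b :* c := c :* b :+ d :* a) ≡.refl
    (seq (re z) n) (seq (im z) n) (seq (re w) n) (seq (im w) n))
  where open +-*-Solver

*-identityˡ : ∀ z → 1ℂ * z ≃ z
*-identityˡ z = ≃-componentwise {1ℂ * z} {z}
  (λ n → solve 2 (λ a b → con 1ℚ :* a :- con 0ℚ :* b := a) ≡.refl (seq (re z) n) (seq (im z) n))
  (λ n → solve 2 (λ a b → con 1ℚ :* b :+ con 0ℚ :* a := b) ≡.refl (seq (re z) n) (seq (im z) n))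
  where open +-*-Solver

≃-refl : ∀ {z} → z ≃ z
≃-refl {z} = ≃-componentwise {z} {z} (λ _ → ≡.refl) (λ _ → ≡.refl)

≃-sym : ∀ {z w} → z ≃ w → w ≃ z
≃-sym {z} {w} (p , q) = ≃ℝ-sym {re z} {re w} p , ≃ℝ-sym {im z} {im w} q

≃-trans : ∀ {z w u} → z ≃ w → w ≃ u → z ≃ u
≃-trans {z} {w} {u} (p , q) (r , s) =
  ≃ℝ-trans {re z} {re w} {re u} p r , ≃ℝ-trans {im z} {im w} {im u} q s

*-identityʳ : ∀ z → z * 1ℂ ≃ z
*-identityʳ z = ≃-trans {z * 1ℂ} {1ℂ * z} {z} (*-comm z 1ℂ) (*-identityˡ z)

*-distribˡ-+ : ∀ z w u → z * (w + u) ≃ z * w + z * u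
*-distribˡ-+ z w u = ≃-componentwise {z * (w + u)} {z * w + z * u}
  (λ n → solve 6 (λ a b c d e f →
      a :* (c :+ e) :- b :* (d :+ f) :=
      (a :* c :- b :* d) :+ (a :* e :- b :* f)) ≡.refl
    (seq (re z) n) (seq (im z) n) (seq (re w) n) (seq (im w) n) (seq (re u) n) (seq (im u) n))
  (λ n → solve 6 (λ a b c d e f →
      a :* (d :+ f) :+ b :* (c :+ e) :=
      (a :* d :+ b :* c) :+ (a :* f :+ b :* e)) ≡.refl
    (seq (re z) n) (seq (im z) n) (seq (re w) n) (seq (im w) n) (seq (re u) n) (seq (im u) n))
  where open +-*-Solver

*-distribʳ-+ : ∀ z w u → (w + u) * z ≃ w * z + u * z
*-distribʳ-+ z w u = ≃-trans {(w + u) * z} {z * (w + u)} {w * z + u * z} (*-comm (w + u) z)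
  (≃-trans {z * (w + u)} {z * w + z * u} {w * z + u * z} (*-distribˡ-+ z w u)
    (+-cong {z * w} {w * z} {z * u} {u * z} (*-comm z w) (*-comm z u)))

ℂ-isCommutativeRing : IsCommutativeRing _≃_ _+_ _*_ -_ 0ℂ 1ℂ
ℂ-isCommutativeRing = record
  { isRing = record
    { +-isAbelianGroup = record
      { isGroup = record
        { isMonoid = record
          { isSemigroup = record
            { isMagma = record
              { isEquivalence = record
                { refl  = λ {z} → ≃-refl {z}
                ; sym   = λ {z} {w} → ≃-sym {z} {w}
                ; trans = λ {z} {w} {u} → ≃-trans {z} {w} {u}
                }
              ; ∙-cong = λ {z} {z′} {w} {w′} → +-cong {z} {z′} {w} {w′}
              }
            ; assoc = +-assoc
            }
          ; identity = +-identityˡ , +-identityʳ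
          }
        ; inverse = +-inverseˡ , +-inverseʳ
        ; ⁻¹-cong = λ {z} {w} → -‿cong {z} {w}
        }
      ; comm = +-comm
      }
    ; *-cong     = λ {z} {z′} {w} {w′} → *-cong {z} {z′} {w} {w′}
    ; *-assoc    = *-assoc
    ; *-identity = *-identityˡ , *-identityʳ
    ; distrib    = *-distribˡ-+ , *-distribʳ-+
    }
  ; *-comm = *-comm
  }

ℂ-commutativeRing : CommutativeRing 0ℓ 0ℓ
ℂ-commutativeRing = record { isCommutativeRing = ℂ-isCommutativeRing }

inverseˡ : ∀ z (z#0 : z #0) → inverse z z#0 * z ≃ 1ℂ
inverseˡ z z#0@(ε , 0<ε , N , ε<) =
  -- The real part is the squared norm times its `recip`, which is known to be 1 only beyond the `N`
  -- of `z#0`. The imaginary part cancels at every index.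
  eventually-≡⇒≃ℝ {re (inverse z z#0 * z)} {1ℝ} N (λ n N≤n → ≡.trans
    (solve 3 (λ a b r → (a :* r) :* a :- ((:- b) :* r) :* b := (a :* a :+ b :* b) :* r) ≡.refl
      (seq (re z) n) (seq (im z) n) (recip (seq (normSq z) n)))
    (*-recip (seq (normSq z) n) (normSq≢0 n N≤n))) ,
  ≗⇒≃ℝ {im (inverse z z#0 * z)} {0ℝ} (λ n →
    solve 3 (λ a b r → (a :* r) :* b :+ ((:- b) :* r) :* a := con 0ℚ) ≡.refl
      (seq (re z) n) (seq (im z) n) (recip (seq (normSq z) n)))
  where
  open +-*-Solver
  normSq≢0 : ∀ n → N ℕ.≤ n → ¬ seq (normSq z) n ≡ 0ℚ
  normSq≢0 n N≤n eq = ℚₚ.<-irrefl (≡.sym eq)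
    (0<p<r-q⇒q<r ε 0ℚ (seq (normSq z) n) 0<ε (ε< n N≤n))

-- Embedding rationals and naturals.

fromℚᶜ-cong : ∀ {p q} → p ≡ q → fromℚᶜ p ≃ fromℚᶜ q
fromℚᶜ-cong {p} ≡.refl = ≃-refl {fromℚᶜ p}

fromℚᶜ-+ : ∀ p q → fromℚᶜ (p ℚ.+ q) ≃ fromℚᶜ p + fromℚᶜ q
fromℚᶜ-+ p q = ≃-componentwise {fromℚᶜ (p ℚ.+ q)} {fromℚᶜ p + fromℚᶜ q}
  (λ _ → ≡.refl) (λ _ → ≡.refl)

fromℚᶜ-* : ∀ p q → fromℚᶜ (p ℚ.* q) ≃ fromℚᶜ p * fromℚᶜ q
fromℚᶜ-* p q = ≃-componentwise {fromℚᶜ (p ℚ.* q)} {fromℚᶜ p * fromℚᶜ q}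
  (λ _ → solve 2 (λ p q → p :* q := p :* q :- con 0ℚ :* con 0ℚ) ≡.refl p q)
  (λ _ → solve 2 (λ p q → con 0ℚ := p :* con 0ℚ :+ con 0ℚ :* q) ≡.refl p q)
  where open +-*-Solver

-- Lets fractions be computed with before reduction to lowest terms, where equality is mere
-- cross-multiplication.
fromℚᵘ-+ : ∀ p q → ℚ.fromℚᵘ (p ℚᵘ.+ q) ≡ ℚ.fromℚᵘ p ℚ.+ ℚ.fromℚᵘ q
fromℚᵘ-+ p q = ℚₚ.toℚᵘ-injective (begin
  ℚ.toℚᵘ (ℚ.fromℚᵘ (p ℚᵘ.+ q))
    ≈⟨ ℚₚ.toℚᵘ-fromℚᵘ (p ℚᵘ.+ q) ⟩
  p ℚᵘ.+ q
    ≈⟨ ℚᵘₚ.+-cong (ℚₚ.toℚᵘ-fromℚᵘ p) (ℚₚ.toℚᵘ-fromℚᵘ q) ⟨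
  ℚ.toℚᵘ (ℚ.fromℚᵘ p) ℚᵘ.+ ℚ.toℚᵘ (ℚ.fromℚᵘ q)
    ≈⟨ ℚₚ.toℚᵘ-homo-+ (ℚ.fromℚᵘ p) (ℚ.fromℚᵘ q) ⟨
  ℚ.toℚᵘ (ℚ.fromℚᵘ p ℚ.+ ℚ.fromℚᵘ q) ∎)
  where open ℚᵘₚ.≃-Reasoning

fromℚᵘ-* : ∀ p q → ℚ.fromℚᵘ (p ℚᵘ.* q) ≡ ℚ.fromℚᵘ p ℚ.* ℚ.fromℚᵘ q
fromℚᵘ-* p q = ℚₚ.toℚᵘ-injective (begin
  ℚ.toℚᵘ (ℚ.fromℚᵘ (p ℚᵘ.* q))
    ≈⟨ ℚₚ.toℚᵘ-fromℚᵘ (p ℚᵘ.* q) ⟩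
  p ℚᵘ.* q
    ≈⟨ ℚᵘₚ.*-cong (ℚₚ.toℚᵘ-fromℚᵘ p) (ℚₚ.toℚᵘ-fromℚᵘ q) ⟨
  ℚ.toℚᵘ (ℚ.fromℚᵘ p) ℚᵘ.* ℚ.toℚᵘ (ℚ.fromℚᵘ q)
    ≈⟨ ℚₚ.toℚᵘ-homo-* (ℚ.fromℚᵘ p) (ℚ.fromℚᵘ q) ⟨
  ℚ.toℚᵘ (ℚ.fromℚᵘ p ℚ.* ℚ.fromℚᵘ q) ∎)
  where open ℚᵘₚ.≃-Reasoning

/1-+ : ∀ m n → ℤ.+ (m ℕ.+ n) ℚ./ 1 ≡ (ℤ.+ m ℚ./ 1) ℚ.+ (ℤ.+ n ℚ./ 1)
/1-+ m n = ≡.trans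
  (ℚₚ.fromℚᵘ-cong {ℚᵘ.mkℚᵘ (ℤ.+ (m ℕ.+ n)) 0} {p ℚᵘ.+ q}
    (ℚᵘ.*≡* (≡.cong (ℤ._* ℤ.+ 1) (≡.sym
      (≡.cong₂ ℤ._+_ (ℤₚ.*-identityʳ (ℤ.+ m)) (ℤₚ.*-identityʳ (ℤ.+ n)))))))
  (fromℚᵘ-+ p q)
  where
  p q : ℚᵘ.ℚᵘ
  p = ℚᵘ.mkℚᵘ (ℤ.+ m) 0
  q = ℚᵘ.mkℚᵘ (ℤ.+ n) 0

/1-* : ∀ m n → ℤ.+ (m ℕ.* n) ℚ./ 1 ≡ (ℤ.+ m ℚ./ 1) ℚ.* (ℤ.+ n ℚ./ 1)
/1-* m n = ≡.trans
  (ℚₚ.fromℚᵘ-cong {ℚᵘ.mkℚᵘ (ℤ.+ (m ℕ.* n)) 0} {p ℚᵘ.* q}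
    (ℚᵘ.*≡* (≡.cong (ℤ._* ℤ.+ 1) (ℤₚ.pos-* m n))))
  (fromℚᵘ-* p q)
  where
  p q : ℚᵘ.ℚᵘ
  p = ℚᵘ.mkℚᵘ (ℤ.+ m) 0
  q = ℚᵘ.mkℚᵘ (ℤ.+ n) 0

n/1*1/n≡1 : ∀ n .{{_ : ℕ.NonZero n}} → (ℤ.+ n ℚ./ 1) ℚ.* (ℤ.+ 1 ℚ./ n) ≡ 1ℚ
n/1*1/n≡1 n@(suc m) = ≡.trans (≡.sym (fromℚᵘ-* p q))
  (ℚₚ.fromℚᵘ-cong {p ℚᵘ.* q} {ℚᵘ.1ℚᵘ} (ℚᵘ.*≡* eq))
  where
  p q : ℚᵘ.ℚᵘ
  p = ℚᵘ.mkℚᵘ (ℤ.+ n) 0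
  -- The second field is the denominator minus one, so this is 1/n.
  q = ℚᵘ.mkℚᵘ (ℤ.+ 1) m
  eq : (ℤ.+ n ℤ.* ℤ.+ 1) ℤ.* ℤ.+ 1 ≡ ℤ.+ 1 ℤ.* ℤ.+ (1 ℕ.* n)
  eq = ≡.trans (ℤₚ.*-identityʳ (ℤ.+ n ℤ.* ℤ.+ 1)) (≡.trans (ℤₚ.*-identityʳ (ℤ.+ n))
    (≡.sym (≡.trans (ℤₚ.*-identityˡ (ℤ.+ (1 ℕ.* n))) (≡.cong ℤ.+_ (ℕₚ.*-identityˡ n)))))

fromℕ-+ : ∀ m n → fromℕ (m ℕ.+ n) ≃ fromℕ m + fromℕ n
fromℕ-+ m n = ≃-trans {fromℕ (m ℕ.+ n)} {fromℚᶜ ((ℤ.+ m ℚ./ 1) ℚ.+ (ℤ.+ n ℚ./ 1))} {fromℕ m + fromℕ n}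
  (fromℚᶜ-cong (/1-+ m n)) (fromℚᶜ-+ (ℤ.+ m ℚ./ 1) (ℤ.+ n ℚ./ 1))

fromℕ-* : ∀ m n → fromℕ (m ℕ.* n) ≃ fromℕ m * fromℕ n
fromℕ-* m n = ≃-trans {fromℕ (m ℕ.* n)} {fromℚᶜ ((ℤ.+ m ℚ./ 1) ℚ.* (ℤ.+ n ℚ./ 1))} {fromℕ m * fromℕ n}
  (fromℚᶜ-cong (/1-* m n)) (fromℚᶜ-* (ℤ.+ m ℚ./ 1) (ℤ.+ n ℚ./ 1))

!-inverse : ∀ n → fromℕ (n !) * 1/! n ≃ 1ℂ
!-inverse n = ≃-trans {fromℕ (n !) * 1/! n} {fromℚᶜ ((ℤ.+ (n !) ℚ./ 1) ℚ.* 1/n!)} {1ℂ}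
  (≃-sym {fromℚᶜ ((ℤ.+ (n !) ℚ./ 1) ℚ.* 1/n!)} {fromℕ (n !) * 1/! n} (fromℚᶜ-* (ℤ.+ (n !) ℚ./ 1) 1/n!))
  (fromℚᶜ-cong (n/1*1/n≡1 (n !) {{n ℕₚ.!≢0}}))
  where
  1/n! : ℚ
  1/n! = ℚ._/_ (ℤ.+ 1) (n !) {{n ℕₚ.!≢0}}

-- Squares about 0 in place of discs.

-- Eventually the approximations of z lie in the open square of side 2r about 0.
InSquare : ℚ → ℂ → Set
InSquare r z = ∃ λ N → ∀ n → N ℕ.≤ n → ℚ.∣ seq (re z) n ∣ ℚ.< r × ℚ.∣ seq (im z) n ∣ ℚ.< r

InSquare-mono : ∀ {r s} z → r ℚ.≤ s → InSquare r z → InSquare s z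
InSquare-mono z r≤s (N , p) = N , λ n N≤n →
  ℚₚ.<-≤-trans (proj₁ (p n N≤n)) r≤s , ℚₚ.<-≤-trans (proj₂ (p n N≤n)) r≤s

-- Approximations of equal numbers agree only up to eventually small errors; the extra s absorbs
-- them.
InSquare-resp-≃ : ∀ {r s} z w → z ≃ w → 0ℚ ℚ.< s → InSquare r z → InSquare (s ℚ.+ r) w
InSquare-resp-≃ {r} {s} z w (p , q) 0<s (N , b) =
  let M₁ , c = ≃ℝ-sym {re z} {re w} p s 0<s
      M₂ , d = ≃ℝ-sym {im z} {im w} q s 0<s
  in N ℕ.⊔ (M₁ ℕ.⊔ M₂) , λ n h →
    let N≤n = ℕₚ.m⊔n≤o⇒m≤o N (M₁ ℕ.⊔ M₂) h
        M≤n = ℕₚ.m⊔n≤o⇒n≤o N (M₁ ℕ.⊔ M₂) h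
    in perturb (seq (re w) n) (seq (re z) n) (c n (ℕₚ.m⊔n≤o⇒m≤o M₁ M₂ M≤n)) (proj₁ (b n N≤n)) ,
       perturb (seq (im w) n) (seq (im z) n) (d n (ℕₚ.m⊔n≤o⇒n≤o M₁ M₂ M≤n)) (proj₂ (b n N≤n))
  where
  perturb : ∀ a b → ℚ.∣ a ℚ.- b ∣ ℚ.< s → ℚ.∣ b ∣ ℚ.< r → ℚ.∣ a ∣ ℚ.< s ℚ.+ r
  perturb a b a-b<s b<r = ≡.subst (λ v → ℚ.∣ v ∣ ℚ.< s ℚ.+ r) (≡.sym (splitAux a b))
    (∣∣-+-< {a ℚ.- b} {b} a-b<s b<r)

InSquare-+ : ∀ {r s} z w → InSquare r z → InSquare s w → InSquare (r ℚ.+ s) (z + w)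
InSquare-+ z w (M , p) (N , q) = M ℕ.⊔ N , λ n h →
  let a , b = p n (ℕₚ.m⊔n≤o⇒m≤o M N h)
      c , d = q n (ℕₚ.m⊔n≤o⇒n≤o M N h)
  in ∣∣-+-< {seq (re z) n} a c , ∣∣-+-< {seq (im z) n} b d

InSquare-* : ∀ {r s} z w → InSquare r z → InSquare s w →
  InSquare (r ℚ.* s ℚ.+ r ℚ.* s) (z * w)
InSquare-* {r} {s} z w (M , p) (N , q) = M ℕ.⊔ N , λ n h →
  let a , b = p n (ℕₚ.m⊔n≤o⇒m≤o M N h)
      c , d = q n (ℕₚ.m⊔n≤o⇒n≤o M N h)
      x = seq (re z) n; y = seq (im z) n; u = seq (re w) n; v = seq (im w) n
  in ∣∣-+-< {x ℚ.* u} (*-mono-<-bounded {x} {u} a c)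
       (∣∣-neg-< {y ℚ.* v} (*-mono-<-bounded {y} {v} b d)) ,
     ∣∣-+-< {x ℚ.* v} (*-mono-<-bounded {x} {v} a d) (*-mono-<-bounded {y} {u} b c)

InSquare-const : ∀ z → ∃ λ r → 0ℚ ℚ.< r × InSquare r z
InSquare-const z =
  let B , 0<B , M , p = bounded {seq (re z)} (cauchy (re z))
      D , 0<D , N , q = bounded {seq (im z)} (cauchy (im z))
      B≤B+D = ≡.subst (ℚ._≤ B ℚ.+ D) (ℚₚ.+-identityʳ B) (ℚₚ.+-monoʳ-≤ B (ℚₚ.<⇒≤ 0<D))
      D≤B+D = ≡.subst (ℚ._≤ B ℚ.+ D) (ℚₚ.+-identityˡ D) (ℚₚ.+-monoˡ-≤ D (ℚₚ.<⇒≤ 0<B))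
  in B ℚ.+ D , ℚₚ.+-mono-< 0<B 0<D , M ℕ.⊔ N , λ n h →
    ℚₚ.<-≤-trans (p n (ℕₚ.m⊔n≤o⇒m≤o M N h)) B≤B+D ,
    ℚₚ.<-≤-trans (q n (ℕₚ.m⊔n≤o⇒n≤o M N h)) D≤B+D

∣∣<⇒InSquare : ∀ {r} z → 0ℚ ℚ.< r → ∣ z ∣< fromℚ r → InSquare r z
∣∣<⇒InSquare {r} z 0<r (ε , 0<ε , N , p) = N , λ n N≤n →
  let x = seq (re z) n; y = seq (im z) n
      xx+yy<rr = 0<p<r-q⇒q<r ε (x ℚ.* x ℚ.+ y ℚ.* y) (r ℚ.* r) 0<ε (p n N≤n)
      xx≤ = ≡.subst (ℚ._≤ x ℚ.* x ℚ.+ y ℚ.* y) (ℚₚ.+-identityʳ (x ℚ.* x))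
              (ℚₚ.+-monoʳ-≤ (x ℚ.* x) (0≤p*p y))
      yy≤ = ≡.subst (ℚ._≤ x ℚ.* x ℚ.+ y ℚ.* y) (ℚₚ.+-identityˡ (y ℚ.* y))
              (ℚₚ.+-monoˡ-≤ (y ℚ.* y) (0≤p*p x))
  in square-cancel-< {x} 0<r (ℚₚ.≤-<-trans xx≤ xx+yy<rr) ,
     square-cancel-< {y} 0<r (ℚₚ.≤-<-trans yy≤ xx+yy<rr)

InSquare⇒∣∣< : ∀ {r} z → 0ℚ ℚ.< r → ∀ ε → fromℚ (r ℚ.+ r) <ℝ ε → InSquare r z → ∣ z ∣< ε
InSquare⇒∣∣< {r} z 0<r ε (η , 0<η , M , p) (N , q) =
  -- The squared norm is below 2r² while ε² exceeds (2r)² = 4r², which leaves the gap 2r². Radius 2r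
  -- in place of the sharp √2 r avoids a square root.
  r ℚ.* r ℚ.+ r ℚ.* r , ℚₚ.+-mono-< (*-pos 0<r 0<r) (*-pos 0<r 0<r) , M ℕ.⊔ N , λ n h →
    let a , b = q n (ℕₚ.m⊔n≤o⇒n≤o M N h)
        x = seq (re z) n; y = seq (im z) n; e = seq ε n
        2r<e = 0<p<r-q⇒q<r η (r ℚ.+ r) e 0<η (p n (ℕₚ.m⊔n≤o⇒m≤o M N h))
    in p+q<r⇒p<r-q (r ℚ.* r ℚ.+ r ℚ.* r) (x ℚ.* x ℚ.+ y ℚ.* y) (e ℚ.* e)
         (ℚₚ.<-trans (ℚₚ.+-monoʳ-< (r ℚ.* r ℚ.+ r ℚ.* r) (ℚₚ.+-mono-< (square-< x a) (square-< y b)))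
           (≡.subst (ℚ._< e ℚ.* e) (square-2r r)
             (square-mono-< (ℚₚ.<⇒≤ (ℚₚ.+-mono-< 0<r 0<r)) 2r<e)))
  where
  square-< : ∀ x → ℚ.∣ x ∣ ℚ.< r → x ℚ.* x ℚ.< r ℚ.* r
  square-< x x<r = ≡.subst (ℚ._< r ℚ.* r) (∣p∣*∣p∣≡p*p x) (square-mono-< (ℚₚ.0≤∣p∣ x) x<r)
  square-2r : ∀ r → (r ℚ.+ r) ℚ.* (r ℚ.+ r) ≡ (r ℚ.* r ℚ.+ r ℚ.* r) ℚ.+ (r ℚ.* r ℚ.+ r ℚ.* r)
  square-2r = solve 1 (λ r → (r :+ r) :* (r :+ r) := (r :* r :+ r :* r) :+ (r :* r :+ r :* r)) ≡.refl
    where open +-*-Solver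

-- Bounded families over the punctured plane, and limits.

ℂ* : Set
ℂ* = Σ ℂ _#0

-- Only parameters near 0 matter for the limit. The unit square is an arbitrary fixed neighbourhood,
-- and `r` must serve all of it at once.
Bounded : (ℂ* → ℂ) → Set
Bounded F = ∃ λ r → 0ℚ ℚ.< r × (∀ c → InSquare 1ℚ (proj₁ c) → InSquare r (F c))

const-bounded : ∀ a → Bounded (λ _ → a)
const-bounded a = let r , 0<r , p = InSquare-const a in r , 0<r , λ _ _ → p

proj₁-bounded : Bounded proj₁
proj₁-bounded = 1ℚ , ℚₚ.positive⁻¹ 1ℚ , λ _ p → p

+-bounded : ∀ F G → Bounded F → Bounded G → Bounded (λ c → F c + G c)
+-bounded F G (r , 0<r , p) (s , 0<s , q) =
  r ℚ.+ s , ℚₚ.+-mono-< 0<r 0<s , λ c h → InSquare-+ (F c) (G c) (p c h) (q c h)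

*-bounded : ∀ F G → Bounded F → Bounded G → Bounded (λ c → F c * G c)
*-bounded F G (r , 0<r , p) (s , 0<s , q) =
  r ℚ.* s ℚ.+ r ℚ.* s , ℚₚ.+-mono-< (*-pos 0<r 0<s) (*-pos 0<r 0<s) ,
  λ c h → InSquare-* (F c) (G c) (p c h) (q c h)

open PowerSeries ℂ-commutativeRing
open DegenerateExponential fromℕ (≃-refl {0ℂ}) (≃-refl {1ℂ}) fromℕ-+ fromℕ-* 1/! !-inverse
  fallingFactorial (λ _ → ≃-refl {1ℂ}) (λ a n → ≃-refl {fallingFactorial a (suc n)})
open Estimates proj₁ Bounded const-bounded proj₁-bounded +-bounded *-bounded

-- The difference f - L equals c Q(c) with Q bounded by r near 0, so it shrinks in proportion to c.
∼⇒Limit₀ : ∀ (f : (c : ℂ) → c #0 → ℂ) {L} → (λ c → f (proj₁ c) (proj₂ c)) ∼ L → Limit₀ f L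
∼⇒Limit₀ f {L} f∼L@(remainder Q (r , 0<r , Q<r) _) ε (e , 0<e , N , e<ε) =
  fromℚ δ , (½ ℚ.* δ , half-pos 0<δ , 0 , λ _ _ → half< δ 0<δ) , λ c c#0 c<δ →
    let i = c , c#0
        c∈δ = ∣∣<⇒InSquare c 0<δ c<δ
        cQ∈ = InSquare-* c (Q i) c∈δ (Q<r i (InSquare-mono c δ≤1 c∈δ))
    in InSquare⇒∣∣< (f c c#0 - L) (ℚₚ.+-mono-< 0<h 0<h) ε 4h<ε
         (InSquare-resp-≃ (c * Q i) (f c c#0 - L)
           (≃-sym {f c c#0 - L} {c * Q i} (difference f∼L i)) 0<h
           (InSquare-mono (c * Q i) δr+δr≤h cQ∈))
  where
  h S δ : ℚ
  -- This is e/8: the product c Q costs h, passing to f - L along `_≃_` another h, and going from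
  -- square to disc doubles 2h to 4h = e/2. The other half of e is the gap below ε.
  h = ½ ℚ.* (½ ℚ.* (½ ℚ.* e))
  0<h : 0ℚ ℚ.< h
  0<h = half-pos (half-pos (half-pos 0<e))
  -- With δ = h/S, the summand 2r gives 2rδ ≤ h, the bound for c Q, and h < S gives δ ≤ 1, so that c
  -- stays where Q is bounded.
  S = (r ℚ.+ r) ℚ.+ h
  0<S : 0ℚ ℚ.< S
  0<S = ℚₚ.+-mono-< (ℚₚ.+-mono-< 0<r 0<r) 0<h
  δ = proj₁ (divide S h 0<S 0<h)
  0<δ : 0ℚ ℚ.< δ
  0<δ = proj₁ (proj₂ (divide S h 0<S 0<h))
  Sδ≡h : S ℚ.* δ ≡ h
  Sδ≡h = proj₂ (proj₂ (divide S h 0<S 0<h))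
  h<S : h ℚ.< S
  h<S = ≡.subst (ℚ._< S) (ℚₚ.+-identityˡ h) (ℚₚ.+-monoˡ-< h (ℚₚ.+-mono-< 0<r 0<r))
  δ≤1 : δ ℚ.≤ 1ℚ
  δ≤1 = ℚₚ.<⇒≤ (ℚₚ.*-cancelˡ-<-nonNeg S {{ℚ.nonNegative (ℚₚ.<⇒≤ 0<S)}}
    (≡.subst₂ ℚ._<_ (≡.sym Sδ≡h) (≡.sym (ℚₚ.*-identityʳ S)) h<S))
  δr+δr≤h : δ ℚ.* r ℚ.+ δ ℚ.* r ℚ.≤ h
  δr+δr≤h = ≡.subst₂ ℚ._≤_
    (solve 2 (λ r δ → (r :+ r) :* δ := δ :* r :+ δ :* r) ≡.refl r δ) Sδ≡h
    (ℚₚ.*-monoʳ-≤-nonNeg δ {{ℚ.nonNegative (ℚₚ.<⇒≤ 0<δ)}}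
      (≡.subst (ℚ._≤ S) (ℚₚ.+-identityʳ (r ℚ.+ r)) (ℚₚ.+-monoʳ-≤ (r ℚ.+ r) (ℚₚ.<⇒≤ 0<h))))
    where open +-*-Solver
  half< : ∀ p → 0ℚ ℚ.< p → ½ ℚ.* p ℚ.< p ℚ.- 0ℚ
  half< p 0<p = p+q<r⇒p<r-q (½ ℚ.* p) 0ℚ p (≡.subst (½ ℚ.* p ℚ.+ 0ℚ ℚ.<_) (half+half p)
    (ℚₚ.+-monoʳ-< (½ ℚ.* p) (half-pos 0<p)))
  4h<ε : fromℚ ((h ℚ.+ h) ℚ.+ (h ℚ.+ h)) <ℝ ε
  4h<ε = ½ ℚ.* e , half-pos 0<e , N , λ n N≤n → p+q<r⇒p<r-q (½ ℚ.* e) ((h ℚ.+ h) ℚ.+ (h ℚ.+ h)) (seq ε n)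
    (≡.subst₂ ℚ._<_
      (≡.trans (≡.sym (half+half e)) (≡.cong (½ ℚ.* e ℚ.+_)
        (≡.sym (≡.trans (≡.cong₂ ℚ._+_ (half+half (½ ℚ.* (½ ℚ.* e))) (half+half (½ ℚ.* (½ ℚ.* e)))) (half+half (½ ℚ.* e))))))
      (ℚₚ.+-identityʳ (seq ε n)) (e<ε n N≤n))

-- Expansions of the operations on series.

powerₛ-∼ : ∀ (G : ℂ* → Series) (g : Series) → (∀ n → (λ c → G c n) ∼ g n) →
  ∀ m n → (λ c → powerₛ (G c) m n) ∼ powerₛ g m n
powerₛ-∼ G g G∼g zero    n = const-∼ (1ₛ n)
powerₛ-∼ G g G∼g (suc m) = ⊛-∼ G (λ c → powerₛ (G c) m) g (powerₛ g m) G∼g (powerₛ-∼ G g G∼g m)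

-- For fixed n the sum over powers stops at n, so no limit is exchanged with an infinite sum.
∘ₛ-∼ : ∀ (f : Series) (G : ℂ* → Series) (g : Series) → (∀ n → (λ c → G c n) ∼ g n) →
  ∀ n → (λ c → (f ∘ₛ G c) n) ∼ (f ∘ₛ g) n
∘ₛ-∼ f G g G∼g n = sum-∼ (suc n) (λ c i → f (toℕ i) * powerₛ (G c) (toℕ i) n)
  (λ i → f (toℕ i) * powerₛ g (toℕ i) n)
  (λ i → *-∼ (const-∼ (f (toℕ i))) (powerₛ-∼ G g G∼g (toℕ i) n))

*ₛ-∼ : ∀ (F G : ℂ* → Series) (f g : Series) →
  (∀ n → (λ c → F c n) ∼ f n) → (∀ n → (λ c → G c n) ∼ g n) →
  ∀ n → (λ c → (F c *ₛ G c) n) ∼ (f *ₛ g) n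
*ₛ-∼ = ⊛-∼

-ₛ-∼ : ∀ (f : Series) (G : ℂ* → Series) (g : Series) → (∀ n → (λ c → G c n) ∼ g n) →
  ∀ n → (λ c → (f -ₛ G c) n) ∼ (f -ₛ g) n
-ₛ-∼ f G g G∼g n = +-∼ {λ _ → f n} {λ c → - G c n} {f n} { - g n}
  (const-∼ (f n)) (-‿∼ {λ c → G c n} {g n} (G∼g n))

egfCoefficient-∼ : ∀ (F : ℂ* → Series) (f : Series) → (∀ n → (λ c → F c n) ∼ f n) →
  ∀ n → (λ c → egfCoefficient (F c) n) ∼ egfCoefficient f n
egfCoefficient-∼ F f F∼f n = *-∼ {λ _ → fromℕ (n !)} {λ c → F c n} {fromℕ (n !)} {f n}
  (const-∼ (fromℕ (n !))) (F∼f n)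

binomialSeries-∼ : ∀ x (a : ℂ* → ℂ) → (∀ c → a c * proj₁ c ≃ x) →
  ∀ n → (λ c → binomialSeries (proj₁ c) (a c) n) ∼ exp[ x ] n
binomialSeries-∼ = binomial-∼-exp

-- The addition formula.

-- In coefficients this is the Chu-Vandermonde identity, obtained here from uniqueness. The
-- exponents a, b, d stand for x/c, y/c and (x + y)/c.
binomialSeries-+ : ∀ c a b d x y → a * c ≃ x → b * c ≃ y → d * c ≃ x + y → ∀ n →
  binomialSeries c d n ≃ (binomialSeries c a *ₛ binomialSeries c b) n
binomialSeries-+ c a b d x y p q r = isDegenerateExp-unique {c} {x + y} {binomialSeries c d}
  (binomial-isDegenerateExp {d} {c} {x + y} r)
  (⊛-isDegenerateExp {c} {x} {y} {binomialSeries c a} {binomialSeries c b}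
    (binomial-isDegenerateExp {a} {c} {x} p) (binomial-isDegenerateExp {b} {c} {y} q))

*ₛ-congˡ : ∀ (f : Series) {g h : Series} → (∀ n → g n ≃ h n) → ∀ n → (f *ₛ g) n ≃ (f *ₛ h) n
*ₛ-congˡ = ⊛-congˡ

*ₛ-assoc : ∀ (f g h : Series) n → ((f *ₛ g) *ₛ h) n ≃ (f *ₛ (g *ₛ h)) n
*ₛ-assoc = ⊛-assoc

egfCoefficient-cong : ∀ {f g : Series} → (∀ n → f n ≃ g n) → ∀ n →
  egfCoefficient f n ≃ egfCoefficient g n
egfCoefficient-cong {f} {g} f≃g n = *-cong {fromℕ (n !)} {fromℕ (n !)} {f n} {g n}
  (≃-refl {fromℕ (n !)}) (f≃g n)

egfCoefficient-*-binomialSeries : ∀ (f : Series) c a n →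
  egfCoefficient (f *ₛ binomialSeries c a) n ≃
  ∑≤ n (λ l → fromℕ (n C l) * fallingFactorial a (n ∸ l) * (c ^ (n ∸ l)) * egfCoefficient f l)
egfCoefficient-*-binomialSeries f c a n = binomial-convolution f c a n

*ₛ-binomialSeries-+ : ∀ (f : Series) c a b d x y → a * c ≃ x → b * c ≃ y → d * c ≃ x + y → ∀ n →
  (f *ₛ binomialSeries c d) n ≃ ((f *ₛ binomialSeries c a) *ₛ binomialSeries c b) n
*ₛ-binomialSeries-+ f c a b d x y p q r n =
  ≃-trans {(f *ₛ binomialSeries c d) n} {(f *ₛ (binomialSeries c a *ₛ binomialSeries c b)) n}
    {((f *ₛ binomialSeries c a) *ₛ binomialSeries c b) n}
    (*ₛ-congˡ f {binomialSeries c d} {binomialSeries c a *ₛ binomialSeries c b}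
      (binomialSeries-+ c a b d x y p q r) n)
    (≃-sym {((f *ₛ binomialSeries c a) *ₛ binomialSeries c b) n}
      {(f *ₛ (binomialSeries c a *ₛ binomialSeries c b)) n}
      (*ₛ-assoc f (binomialSeries c a) (binomialSeries c b) n))

-- In the application f is the polylogarithm factor. It does not involve x, so the shift by y is
-- multiplication by one further binomial series.
egfCoefficient-addition : ∀ (f : Series) c a b d x y →
  a * c ≃ x → b * c ≃ y → d * c ≃ x + y → ∀ n →
  egfCoefficient (f *ₛ binomialSeries c d) n ≃
  ∑≤ n (λ l → fromℕ (n C l) * fallingFactorial b (n ∸ l) * (c ^ (n ∸ l))
    * egfCoefficient (f *ₛ binomialSeries c a) l)
egfCoefficient-addition f c a b d x y p q r n =
  ≃-trans {egfCoefficient (f *ₛ binomialSeries c d) n}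
    {egfCoefficient ((f *ₛ binomialSeries c a) *ₛ binomialSeries c b) n}
    {∑≤ n (λ l → fromℕ (n C l) * fallingFactorial b (n ∸ l) * (c ^ (n ∸ l))
      * egfCoefficient (f *ₛ binomialSeries c a) l)}
    (egfCoefficient-cong {f *ₛ binomialSeries c d} {(f *ₛ binomialSeries c a) *ₛ binomialSeries c b}
      (*ₛ-binomialSeries-+ f c a b d x y p q r) n)
    (egfCoefficient-*-binomialSeries (f *ₛ binomialSeries c a) c b n)

degeneratePolyBernoulli-+ : ∀ k n x y c (c#0 : c #0) →
  degeneratePolyBernoulli k n c c#0 (x + y)
    ≃ ∑≤ n (λ l → fromℕ (n C l) * fallingFactorial (y * inverse c c#0) (n ∸ l)
        * (c ^ (n ∸ l)) * degeneratePolyBernoulli k l c c#0 x)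
degeneratePolyBernoulli-+ k n x y c c#0 = egfCoefficient-addition
  (Li/u k ∘ₛ (1ₛ -ₛ binomialSeries c (- inverse c c#0))) c
  (x * inverse c c#0) (y * inverse c c#0) ((x + y) * inverse c c#0) x y
  (cancel x) (cancel y) (cancel (x + y)) n
  where
  cancel : ∀ z → z * inverse c c#0 * c ≃ z
  cancel z = inverse-cancelʳ z (inverse c c#0) c (inverseˡ c c#0)

-- Expansion of the generating function at 0.

-- The substituted series and the outer factor are both covered by `binomialSeries-∼`, once at -1
-- and once at x.
egfCoefficient-∘ₛ-∼ : ∀ (f : Series) x (a b : ℂ* → ℂ) →
  (∀ c → a c * proj₁ c ≃ - 1ℂ) → (∀ c → b c * proj₁ c ≃ x) → ∀ n →
  (λ c → egfCoefficient ((f ∘ₛ (1ₛ -ₛ binomialSeries (proj₁ c) (a c)))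
                           *ₛ binomialSeries (proj₁ c) (b c)) n)
    ∼ egfCoefficient ((f ∘ₛ (1ₛ -ₛ exp[ - 1ℂ ])) *ₛ exp[ x ]) n
egfCoefficient-∘ₛ-∼ f x a b p q = egfCoefficient-∼
  (λ c → (f ∘ₛ (1ₛ -ₛ binomialSeries (proj₁ c) (a c))) *ₛ binomialSeries (proj₁ c) (b c))
  ((f ∘ₛ (1ₛ -ₛ exp[ - 1ℂ ])) *ₛ exp[ x ])
  (*ₛ-∼ (λ c → f ∘ₛ (1ₛ -ₛ binomialSeries (proj₁ c) (a c))) (λ c → binomialSeries (proj₁ c) (b c))
    (f ∘ₛ (1ₛ -ₛ exp[ - 1ℂ ])) exp[ x ]
    (∘ₛ-∼ f (λ c → 1ₛ -ₛ binomialSeries (proj₁ c) (a c)) (1ₛ -ₛ exp[ - 1ℂ ])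
      (-ₛ-∼ 1ₛ (λ c → binomialSeries (proj₁ c) (a c)) exp[ - 1ℂ ]
        (binomialSeries-∼ (- 1ℂ) a p)))
    (binomialSeries-∼ x b q))

degeneratePolyBernoulli-∼ : ∀ k n x →
  (λ c → degeneratePolyBernoulli k n (proj₁ c) (proj₂ c) x) ∼ polyBernoulli k n x
degeneratePolyBernoulli-∼ k n x = egfCoefficient-∘ₛ-∼ (Li/u k) x
  (λ c → - inverse (proj₁ c) (proj₂ c)) (λ c → x * inverse (proj₁ c) (proj₂ c))
  (λ c → neg-inverse (inverse (proj₁ c) (proj₂ c)) (proj₁ c) (inverseˡ (proj₁ c) (proj₂ c)))
  (λ c → inverse-cancelʳ x (inverse (proj₁ c) (proj₂ c)) (proj₁ c) (inverseˡ (proj₁ c) (proj₂ c)))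
  n

theorem1 : ∀ (k : ℤ) (n : ℕ) (x y : ℂ) →
    (∀ (c : ℂ) (c#0 : c #0) →
    degeneratePolyBernoulli k n c c#0 (x + y)
    ≃ ∑≤ n (λ l →
    fromℕ (n C l) * fallingFactorial (y * inverse c c#0) (n ∸ l)
    * (c ^ (n ∸ l)) * degeneratePolyBernoulli k l c c#0 x))
    × Limit₀ (λ c c#0 → degeneratePolyBernoulli k n c c#0 x)
    (polyBernoulli k n x)
theorem1 k n x y = degeneratePolyBernoulli-+ k n x y ,
  ∼⇒Limit₀ (λ c c#0 → degeneratePolyBernoulli k n c c#0 x) (degeneratePolyBernoulli-∼ k n x)
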